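{- Let $\mathcal{C}$ be a prop and $\mathcal{A}$ a sub-prop such that: $\mathcal{C}$ has pushouts and pullbacks; $(\mathcal{E},\mathcal{M})$ is a costable factorisation system on $\mathcal{C}$ with every morphism of $\mathcal{M}$ a monomorphism; $\mathcal{A}$ contains $\mathcal{M}$, is stable under pullback, and for every cospan $X\xrightarrow{f}A\xleftarrow{g}Y$ in $\mathcal{A}$ the induced morphism from the pushout of its pullback span to $A$ lies in $\mathcal{M}$. Suppose that the monoidal product of $\mathcal{C}$ preserves pushouts in $\mathcal{C}$ and pullbacks in $\mathcal{A}$, and that $\mathcal{M}$ is closed under the monoidal product. Then the square with top arrow $\mathcal{A}+\mathcal{A}^{op}\to\mathrm{Span}(\mathcal{A})$, left arrow $\mathcal{A}+\mathcal{A}^{op}\to\mathrm{Cospan}(\mathcal{C})$, right arrow $\Pi\colon\mathrm{Span}(\mathcal{A})\to\mathrm{Corel}(\mathcal{C})$ and bottom arrow $\Gamma\colon\mathrm{Cospan}(\mathcal{C})\to\mathrm{Corel}(\mathcal{C})$ is a pushout in $\mathbf{PROP}$.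
   Context: A prop is a strict symmetric monoidal category whose objects are the natural numbers with $n\otimes m=n+m$; $\mathbf{PROP}$ is the category of props and identity-on-objects strict symmetric monoidal functors; $\mathcal{A}+\mathcal{A}^{op}$ is the coproduct in $\mathbf{PROP}$, whose morphisms are finite alternating zigzags of non-identity morphisms of $\mathcal{A}$ composed by concatenation. Composition is written diagrammatically. Factorisation system $(\mathcal{E},\mathcal{M})$: subcategories containing all isomorphisms, every morphism factors as $e;m$, with unique diagonal fill-ins. Costable: $\mathcal{M}$ stable under pushout. $\mathcal{A}$ stable under pullback: in a pullback square, if a morphism into the corner is in $\mathcal{A}$, so is the opposite side. $\otimes$ preserves pushouts in $\mathcal{C}$: $(N\otimes N')+_{Y\otimes Y'}(M\otimes M')\cong(N+_YM)\otimes(N'+_{Y'}M')$ for all spans $N\leftarrow Y\to M$, $N'\leftarrow Y'\to M'$ in $\mathcal{C}$; preserves pullbacks in $\mathcal{A}$: analogous isomorphism of pullbacks (in $\mathcal{C}$) for cospans in $\mathcal{A}$. $\mathcal{M}$ closed under $\otimes$: $f\otimes g\in\mathcal{M}$ for $f,g\in\mathcal{M}$. $\mathrm{Cospan}(\mathcal{C})$, $\mathrm{Span}(\mathcal{A})$: props of isomorphism classes of cospans in $\mathcal{C}$ (resp. spans with legs in $\mathcal{A}$) composed by pushout/pullback, monoidal product componentwise. $\mathrm{Corel}(\mathcal{C})$: cospans modulo the equivalence generated by $(f,g)\sim(f;m,g;m)$ for $m\in\mathcal{M}$. $\Gamma$ sends a cospan to its corelation, $\Pi$ sends a span to the corelation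 of its pushout cospan; the map to $\mathrm{Span}(\mathcal{A})$ sends forward $f\mapsto(\mathrm{id},f)$, backward $g\mapsto(g,\mathrm{id})$, the map to $\mathrm{Cospan}(\mathcal{C})$ forward $f\mapsto(f,\mathrm{id})$, backward $g\mapsto(\mathrm{id},g)$. -}

module Defs where

open import Data.Nat.Base using (ℕ; zero; _+_)
open import Data.Nat.Properties using (+-assoc; +-identityʳ)
open import Data.Product.Base using (Σ-syntax; _×_; _,_; proj₁; proj₂)
open import Data.Sum.Base using (_⊎_; inj₁; inj₂)
open import Data.Unit.Polymorphic.Base using (⊤)
open import Level using (Level; 0ℓ; suc; _⊔_)
open import Relation.Binary.Bundles using (Setoid)
open import Relation.Binary.Construct.Closure.Equivalence as EqC using (EqClosure)
open import Relation.Binary.Construct.Closure.ReflexiveTransitive using (Star; ε; _◅_; _◅◅_; gmap)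
open import Relation.Binary.Construct.Closure.ReflexiveTransitive.Properties using (◅◅-assoc; gmap-id; gmap-∘; gmap-◅◅)
open import Relation.Binary.Core using (Rel)
open import Relation.Binary.PropositionalEquality.Core as ≡ using (_≡_)
open import Relation.Binary.Structures using (IsEquivalence)
import Relation.Binary.Reasoning.Setoid as SetoidReasoning

private
  variable
    o ℓ : Level

------------------------------------------------------------------------

-- Hom-sets are setoids, and composition is written diagrammatically.

record Category (ℓ : Level) (Obj : Set o) : Set (o ⊔ suc ℓ) where
  infix  4 _≈_
  infixr 9 _⨾_
  field
    Hom           : Obj → Obj → Set ℓ
    _≈_           : ∀ {X Y} → Rel (Hom X Y) ℓ
    isEquivalence : ∀ {X Y} → IsEquivalence (_≈_ {X} {Y})
    id            : ∀ {X} → Hom X X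
    _⨾_           : ∀ {X Y Z} → Hom X Y → Hom Y Z → Hom X Z
    ⨾-cong        : ∀ {X Y Z} {f f′ : Hom X Y} {g g′ : Hom Y Z} →
                    f ≈ f′ → g ≈ g′ → f ⨾ g ≈ f′ ⨾ g′
    assoc         : ∀ {W X Y Z} {f : Hom W X} {g : Hom X Y} {h : Hom Y Z} →
                    (f ⨾ g) ⨾ h ≈ f ⨾ (g ⨾ h)
    identityˡ     : ∀ {X Y} {f : Hom X Y} → id ⨾ f ≈ f
    identityʳ     : ∀ {X Y} {f : Hom X Y} → f ⨾ id ≈ f

  homSetoid : ∀ {X Y} → Setoid ℓ ℓ
  homSetoid {X} {Y} = record { isEquivalence = isEquivalence {X} {Y} }

  ≈-refl : ∀ {X Y} {f : Hom X Y} → f ≈ f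
  ≈-refl = IsEquivalence.refl isEquivalence

  ≈-sym : ∀ {X Y} {f g : Hom X Y} → f ≈ g → g ≈ f
  ≈-sym = IsEquivalence.sym isEquivalence

  ≈-trans : ∀ {X Y} {f g h : Hom X Y} → f ≈ g → g ≈ h → f ≈ h
  ≈-trans = IsEquivalence.trans isEquivalence

  ⨾-congˡ : ∀ {X Y Z} {f : Hom X Y} {g g′ : Hom Y Z} → g ≈ g′ → f ⨾ g ≈ f ⨾ g′
  ⨾-congˡ = ⨾-cong ≈-refl

  ⨾-congʳ : ∀ {X Y Z} {f f′ : Hom X Y} {g : Hom Y Z} → f ≈ f′ → f ⨾ g ≈ f′ ⨾ g
  ⨾-congʳ p = ⨾-cong p ≈-refl

  -- An identity morphism between two objects that are equal, but not
  -- necessarily definitionally so.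
  coe : ∀ {X Y} → X ≡ Y → Hom X Y
  coe ≡.refl = id

  record IsIso {X Y} (f : Hom X Y) : Set ℓ where
    field
      inv  : Hom Y X
      invʳ : f ⨾ inv ≈ id
      invˡ : inv ⨾ f ≈ id

  IsMono : ∀ {X Y} → Hom X Y → Set (o ⊔ ℓ)
  IsMono {X} f = ∀ {W} {g h : Hom W X} → g ⨾ f ≈ h ⨾ f → g ≈ h

  record IsPushout {Y N M P} (f : Hom Y N) (g : Hom Y M)
                   (i : Hom N P) (j : Hom M P) : Set (o ⊔ ℓ) where
    field
      commute    : f ⨾ i ≈ g ⨾ j
      universal  : ∀ {X} {h : Hom N X} {k : Hom M X} → f ⨾ h ≈ g ⨾ k → Hom P X
      universal₁ : ∀ {X} {h : Hom N X} {k : Hom M X} (eq : f ⨾ h ≈ g ⨾ k) →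
                   i ⨾ universal eq ≈ h
      universal₂ : ∀ {X} {h : Hom N X} {k : Hom M X} (eq : f ⨾ h ≈ g ⨾ k) →
                   j ⨾ universal eq ≈ k
      unique     : ∀ {X} {h : Hom N X} {k : Hom M X} (eq : f ⨾ h ≈ g ⨾ k)
                   {u : Hom P X} → i ⨾ u ≈ h → j ⨾ u ≈ k → u ≈ universal eq

  record Pushout {Y N M} (f : Hom Y N) (g : Hom Y M) : Set (o ⊔ ℓ) where
    field
      {apex}    : Obj
      in₁       : Hom N apex
      in₂       : Hom M apex
      isPushout : IsPushout f g in₁ in₂

  HasPushouts : Set (o ⊔ ℓ)
  HasPushouts = ∀ {Y N M} (f : Hom Y N) (g : Hom Y M) → Pushout f g

  record IsCoproduct {X Y S} (i : Hom X S) (j : Hom Y S) : Set (o ⊔ ℓ) where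
    field
      [_,_]   : ∀ {Z} → Hom X Z → Hom Y Z → Hom S Z
      inject₁ : ∀ {Z} {h : Hom X Z} {k : Hom Y Z} → i ⨾ [ h , k ] ≈ h
      inject₂ : ∀ {Z} {h : Hom X Z} {k : Hom Y Z} → j ⨾ [ h , k ] ≈ k
      unique  : ∀ {Z} {h : Hom X Z} {k : Hom Y Z} {u : Hom S Z} →
                i ⨾ u ≈ h → j ⨾ u ≈ k → u ≈ [ h , k ]

  MorphismClass : Set (o ⊔ suc ℓ)
  MorphismClass = ∀ {X Y} → Hom X Y → Set ℓ

opposite : {Obj : Set o} → Category ℓ Obj → Category ℓ Obj
opposite 𝒞 = record
  { Hom           = λ X Y → Hom Y X
  ; _≈_           = _≈_
  ; isEquivalence = isEquivalence
  ; id            = id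
  ; _⨾_           = λ f g → g ⨾ f
  ; ⨾-cong        = λ p q → ⨾-cong q p
  ; assoc         = ≈-sym assoc
  ; identityˡ     = identityʳ
  ; identityʳ     = identityˡ
  } where open Category 𝒞

module _ {Obj : Set o} (𝒞 : Category ℓ Obj) where
  open Category 𝒞

  -- Unfolded: p ⨾ f ≈ q ⨾ g, universally among such pairs (p , q).
  IsPullback : ∀ {X Y Z P} (f : Hom X Z) (g : Hom Y Z) (p : Hom P X) (q : Hom P Y) →
               Set (o ⊔ ℓ)
  IsPullback = Category.IsPushout (opposite 𝒞)

  pullback-commute : ∀ {X Y Z P} {f : Hom X Z} {g : Hom Y Z} {p : Hom P X} {q : Hom P Y} →
                     IsPullback f g p q → p ⨾ f ≈ q ⨾ g
  pullback-commute = Category.IsPushout.commute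

  HasPullbacks : Set (o ⊔ ℓ)
  HasPullbacks = Category.HasPushouts (opposite 𝒞)

  StableUnderPushout : Category.MorphismClass 𝒞 → Set (o ⊔ ℓ)
  StableUnderPushout K =
    ∀ {Y N M P} {f : Hom Y N} {g : Hom Y M} {i : Hom N P} {j : Hom M P} →
    IsPushout f g i j → K f → K j

  record IsSubcategoryWithIsos (K : MorphismClass) : Set (o ⊔ ℓ) where
    field
      resp-≈   : ∀ {X Y} {f g : Hom X Y} → f ≈ g → K f → K g
      ⨾-closed : ∀ {X Y Z} {f : Hom X Y} {g : Hom Y Z} → K f → K g → K (f ⨾ g)
      isos     : ∀ {X Y} {f : Hom X Y} → IsIso f → K f

  record Diagonal {X Y Z W} (e : Hom X Y) (m : Hom Z W)
                  (u : Hom X Z) (v : Hom Y W) : Set ℓ where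
    field
      diagonal : Hom Y Z
      upper    : e ⨾ diagonal ≈ u
      lower    : diagonal ⨾ m ≈ v
      unique   : ∀ {d} → e ⨾ d ≈ u → d ⨾ m ≈ v → d ≈ diagonal

  record IsFactorisationSystem (E M : MorphismClass) : Set (o ⊔ ℓ) where
    field
      E-subcategory : IsSubcategoryWithIsos E
      M-subcategory : IsSubcategoryWithIsos M
      factor        : ∀ {X Y} (f : Hom X Y) →
                      Σ[ Z ∈ Obj ] Σ[ e ∈ Hom X Z ] Σ[ m ∈ Hom Z Y ]
                        E e × M m × f ≈ e ⨾ m
      fill-in       : ∀ {X Y Z W} {e : Hom X Y} {m : Hom Z W}
                      {u : Hom X Z} {v : Hom Y W} →
                      E e → M m → e ⨾ v ≈ u ⨾ m → Diagonal e m u v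

StableUnderPullback : {Obj : Set o} (𝒞 : Category ℓ Obj) →
                      Category.MorphismClass 𝒞 → Set (o ⊔ ℓ)
StableUnderPullback 𝒞 K = StableUnderPushout (opposite 𝒞) K

------------------------------------------------------------------------

-- Objects are only propositionally associative and unital, so the strictness
-- of the monoidal product is expressed by naturality of the identities coe.
-- (Strict left unitality holds on objects by computation.)

record PropCategory (ℓ : Level) : Set (suc ℓ) where
  infixr 10 _⊗_
  field
    category : Category ℓ ℕ
  open Category category public
  field
    _⊗_          : ∀ {m n m′ n′} → Hom m n → Hom m′ n′ → Hom (m + m′) (n + n′)
    ⊗-cong       : ∀ {m n m′ n′} {f g : Hom m n} {f′ g′ : Hom m′ n′} →
                   f ≈ g → f′ ≈ g′ → f ⊗ f′ ≈ g ⊗ g′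
    ⊗-id         : ∀ {m n} → id {m} ⊗ id {n} ≈ id
    ⊗-⨾          : ∀ {m n k m′ n′ k′} {f : Hom m n} {g : Hom n k}
                   {f′ : Hom m′ n′} {g′ : Hom n′ k′} →
                   (f ⨾ g) ⊗ (f′ ⨾ g′) ≈ (f ⊗ f′) ⨾ (g ⊗ g′)
    ⊗-assoc      : ∀ {m n m′ n′ m″ n″}
                   {f : Hom m n} {f′ : Hom m′ n′} {f″ : Hom m″ n″} →
                   ((f ⊗ f′) ⊗ f″) ⨾ coe (+-assoc n n′ n″) ≈
                   coe (+-assoc m m′ m″) ⨾ (f ⊗ (f′ ⊗ f″))
    ⊗-identityˡ  : ∀ {m n} {f : Hom m n} → id {zero} ⊗ f ≈ f
    ⊗-identityʳ  : ∀ {m n} {f : Hom m n} →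
                   (f ⊗ id {zero}) ⨾ coe (+-identityʳ n) ≈ coe (+-identityʳ m) ⨾ f
    σ            : ∀ m n → Hom (m + n) (n + m)
    σ-natural    : ∀ {m n m′ n′} {f : Hom m n} {f′ : Hom m′ n′} →
                   (f ⊗ f′) ⨾ σ n n′ ≈ σ m m′ ⨾ (f′ ⊗ f)
    σ-involutive : ∀ {m n} → σ m n ⨾ σ n m ≈ id
    σ-hexagon    : ∀ {m n k} →
                   coe (+-assoc m n k) ⨾ σ m (n + k) ⨾ coe (+-assoc n k m) ≈
                   (σ m n ⊗ id) ⨾ coe (+-assoc n m k) ⨾ (id {n} ⊗ σ m k)

record PropFunctor (P Q : PropCategory ℓ) : Set ℓ where
  private
    module P = PropCategory P
    module Q = PropCategory Q
  field
    map      : ∀ {m n} → P.Hom m n → Q.Hom m n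
    map-cong : ∀ {m n} {f g : P.Hom m n} → f P.≈ g → map f Q.≈ map g
    map-id   : ∀ {n} → map (P.id {n}) Q.≈ Q.id
    map-⨾    : ∀ {m n k} {f : P.Hom m n} {g : P.Hom n k} →
               map (f P.⨾ g) Q.≈ map f Q.⨾ map g
    map-⊗    : ∀ {m n m′ n′} {f : P.Hom m n} {g : P.Hom m′ n′} →
               map (f P.⊗ g) Q.≈ map f Q.⊗ map g
    map-σ    : ∀ {m n} → map (P.σ m n) Q.≈ Q.σ m n

  map-coe : ∀ {m n} (e : m ≡ n) → map (P.coe e) Q.≈ Q.coe e
  map-coe ≡.refl = map-id

PROP : ∀ ℓ → Category ℓ (PropCategory ℓ)
PROP ℓ = record
  { Hom           = PropFunctor
  ; _≈_           = λ {P} {Q} F G → ∀ {m n} (f : PropCategory.Hom P m n) →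
                      PropCategory._≈_ Q (PropFunctor.map F f) (PropFunctor.map G f)
  ; isEquivalence = λ {P} {Q} → let open PropCategory Q in record
      { refl  = λ f → ≈-refl
      ; sym   = λ p f → ≈-sym (p f)
      ; trans = λ p q f → ≈-trans (p f) (q f)
      }
  ; id            = λ {P} → let open PropCategory P in record
      { map      = λ f → f
      ; map-cong = λ p → p
      ; map-id   = ≈-refl
      ; map-⨾    = ≈-refl
      ; map-⊗    = ≈-refl
      ; map-σ    = ≈-refl
      }
  ; _⨾_           = λ {P} {Q} {R} F G →
      let open PropCategory R
          module F = PropFunctor F
          module G = PropFunctor G
      in record
      { map      = λ f → G.map (F.map f)
      ; map-cong = λ p → G.map-cong (F.map-cong p)
      ; map-id   = ≈-trans (G.map-cong F.map-id) G.map-id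
      ; map-⨾    = ≈-trans (G.map-cong F.map-⨾) G.map-⨾
      ; map-⊗    = ≈-trans (G.map-cong F.map-⊗) G.map-⊗
      ; map-σ    = ≈-trans (G.map-cong F.map-σ) G.map-σ
      }
  ; ⨾-cong        = λ {P} {Q} {R} {F} {F′} {G} {G′} p q f →
      PropCategory.≈-trans R (PropFunctor.map-cong G (p f)) (q (PropFunctor.map F′ f))
  ; assoc         = λ {P} {Q} {R} {S} f → PropCategory.≈-refl S
  ; identityˡ     = λ {P} {Q} f → PropCategory.≈-refl Q
  ; identityʳ     = λ {P} {Q} f → PropCategory.≈-refl Q
  }

------------------------------------------------------------------------

module CategoryLemmas {Obj : Set o} (𝒞 : Category ℓ Obj) where
  open Category 𝒞

  module Reasoning {X Y : Obj} = SetoidReasoning (homSetoid {X} {Y})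

  pullˡ : ∀ {W X Y Z} {f : Hom W X} {g : Hom X Y} {fg : Hom W Y} {h : Hom Y Z} →
          f ⨾ g ≈ fg → f ⨾ (g ⨾ h) ≈ fg ⨾ h
  pullˡ p = ≈-trans (≈-sym assoc) (⨾-congʳ p)

  pullʳ : ∀ {W X Y Z} {f : Hom W X} {g : Hom X Y} {h : Hom Y Z} {gh : Hom X Z} →
          g ⨾ h ≈ gh → (f ⨾ g) ⨾ h ≈ f ⨾ gh
  pullʳ p = ≈-trans assoc (⨾-congˡ p)

  cancelˡ : ∀ {W X Y} {f : Hom X W} {g : Hom W X} {h : Hom X Y} →
            f ⨾ g ≈ id → f ⨾ (g ⨾ h) ≈ h
  cancelˡ p = ≈-trans (pullˡ p) identityˡ

  cancelʳ : ∀ {W X Y} {f : Hom X Y} {g : Hom Y W} {h : Hom W Y} →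
            g ⨾ h ≈ id → (f ⨾ g) ⨾ h ≈ f
  cancelʳ p = ≈-trans (pullʳ p) identityʳ

  coe-sym : ∀ {X Y} (e : X ≡ Y) → coe e ⨾ coe (≡.sym e) ≈ id
  coe-sym ≡.refl = identityˡ

  coe-sym′ : ∀ {X Y} (e : X ≡ Y) → coe (≡.sym e) ⨾ coe e ≈ id
  coe-sym′ ≡.refl = identityˡ

  coe-iso : ∀ {X Y} (e : X ≡ Y) → IsIso (coe e)
  coe-iso e = record { inv = coe (≡.sym e) ; invʳ = coe-sym e ; invˡ = coe-sym′ e }

  id-iso : ∀ {X} → IsIso (id {X})
  id-iso = coe-iso ≡.refl

  inv-iso : ∀ {X Y} {f : Hom X Y} (u : IsIso f) → IsIso (IsIso.inv u)
  inv-iso {f = f} u = record { inv = f ; invʳ = IsIso.invˡ u ; invˡ = IsIso.invʳ u }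

  ⨾-iso : ∀ {X Y Z} {f : Hom X Y} {g : Hom Y Z} → IsIso f → IsIso g → IsIso (f ⨾ g)
  ⨾-iso u v = record
    { inv  = V.inv ⨾ U.inv
    ; invʳ = ≈-trans (pullʳ (cancelˡ V.invʳ)) U.invʳ
    ; invˡ = ≈-trans (pullʳ (cancelˡ U.invˡ)) V.invˡ
    } where module U = IsIso u
            module V = IsIso v

  -- A square whose vertical sides are a , b and horizontal sides are f , g,
  -- transposed along invertible horizontal sides.
  transpose : ∀ {X Y Z W} {f : Hom X Y} {b : Hom Y W} {a : Hom X Z} {g : Hom Z W} →
              (u : IsIso f) (v : IsIso g) → f ⨾ b ≈ a ⨾ g →
              b ⨾ IsIso.inv v ≈ IsIso.inv u ⨾ a
  transpose {f = f} {b} {a} {g} u v p = begin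
    b ⨾ V.inv                    ≈⟨ cancelˡ U.invˡ ⟨
    U.inv ⨾ (f ⨾ (b ⨾ V.inv))    ≈⟨ ⨾-congˡ (pullˡ p) ⟩
    U.inv ⨾ ((a ⨾ g) ⨾ V.inv)    ≈⟨ ⨾-congˡ (cancelʳ V.invʳ) ⟩
    U.inv ⨾ a                    ∎
    where open Reasoning
          module U = IsIso u
          module V = IsIso v

  inv-unique : ∀ {X Y} {f : Hom X Y} {g h : Hom Y X} → g ⨾ f ≈ id → f ⨾ h ≈ id → g ≈ h
  inv-unique p q = ≈-trans (≈-sym (cancelʳ q)) (≈-trans (⨾-congʳ p) identityˡ)

module PushoutLemmas {Obj : Set o} (𝒞 : Category ℓ Obj) where
  open Category 𝒞
  open CategoryLemmas 𝒞

  po-swap : ∀ {Y N M P} {f : Hom Y N} {g : Hom Y M} {i : Hom N P} {j : Hom M P} →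
            IsPushout f g i j → IsPushout g f j i
  po-swap po = record
    { commute    = ≈-sym commute
    ; universal  = λ p → universal (≈-sym p)
    ; universal₁ = λ p → universal₂ (≈-sym p)
    ; universal₂ = λ p → universal₁ (≈-sym p)
    ; unique     = λ p q r → unique (≈-sym p) r q
    } where open IsPushout po

  po-unique : ∀ {Y N M P X} {f : Hom Y N} {g : Hom Y M} {i : Hom N P} {j : Hom M P} →
              IsPushout f g i j → {u v : Hom P X} → i ⨾ u ≈ i ⨾ v → j ⨾ u ≈ j ⨾ v → u ≈ v
  po-unique po {u} {v} p q =
    ≈-trans (unique e p q) (≈-sym (unique e ≈-refl ≈-refl))
    where open IsPushout po
          e = ≈-trans (pullˡ commute) assoc

  po-iso : ∀ {Y N M P P′} {f : Hom Y N} {g : Hom Y M}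
           {i : Hom N P} {j : Hom M P} {i′ : Hom N P′} {j′ : Hom M P′} →
           (po : IsPushout f g i j) (po′ : IsPushout f g i′ j′) →
           IsIso (IsPushout.universal po (IsPushout.commute po′))
  po-iso po po′ = record
    { inv  = P′.universal P.commute
    ; invʳ = po-unique po
        (≈-trans (pullˡ (P.universal₁ _)) (≈-trans (P′.universal₁ _) (≈-sym identityʳ)))
        (≈-trans (pullˡ (P.universal₂ _)) (≈-trans (P′.universal₂ _) (≈-sym identityʳ)))
    ; invˡ = po-unique po′
        (≈-trans (pullˡ (P′.universal₁ _)) (≈-trans (P.universal₁ _) (≈-sym identityʳ)))
        (≈-trans (pullˡ (P′.universal₂ _)) (≈-trans (P.universal₂ _) (≈-sym identityʳ)))
    } where module P  = IsPushout po
            module P′ = IsPushout po′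

  po-paste : ∀ {Y N M P N′ P′} {f : Hom Y N} {g : Hom Y M} {i : Hom N P} {j : Hom M P}
             {f′ : Hom N N′} {i′ : Hom N′ P′} {p : Hom P P′} →
             IsPushout f g i j → IsPushout f′ i i′ p → IsPushout (f ⨾ f′) g i′ (j ⨾ p)
  po-paste {f = f} {g} {i} {j} {f′} {i′} {p} po po′ = record
    { commute    = ≈-trans (pullʳ R.commute) (≈-trans (pullˡ L.commute) assoc)
    ; universal  = λ eq → R.universal (mid eq)
    ; universal₁ = λ eq → R.universal₁ (mid eq)
    ; universal₂ = λ eq → ≈-trans (pullʳ (R.universal₂ (mid eq))) (L.universal₂ _)
    ; unique     = λ eq a b → R.unique (mid eq) a
        (L.unique _ (≈-trans (pullˡ (≈-sym R.commute)) (pullʳ a)) (≈-trans (≈-sym assoc) b))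
    } where
      module L = IsPushout po
      module R = IsPushout po′
      mid : ∀ {X} {h : Hom _ X} {k : Hom _ X} (eq : (f ⨾ f′) ⨾ h ≈ g ⨾ k) →
            f′ ⨾ h ≈ i ⨾ L.universal (≈-trans (≈-sym assoc) eq)
      mid eq = ≈-sym (L.universal₁ (≈-trans (≈-sym assoc) eq))

  po-mediate : ∀ {Y N M P N′ P′} {f : Hom Y N} {g : Hom Y M} {i : Hom N P} {j : Hom M P}
               {f′ : Hom N N′} {i′ : Hom N′ P′} {j′ : Hom M P′} →
               IsPushout f g i j → IsPushout (f ⨾ f′) g i′ j′ → Hom P P′
  po-mediate po po′ =
    IsPushout.universal po (≈-trans (≈-sym assoc) (IsPushout.commute po′))

  po-cancel : ∀ {Y N M P N′ P′} {f : Hom Y N} {g : Hom Y M} {i : Hom N P} {j : Hom M P}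
              {f′ : Hom N N′} {i′ : Hom N′ P′} {j′ : Hom M P′} →
              (po : IsPushout f g i j) (po′ : IsPushout (f ⨾ f′) g i′ j′) →
              IsPushout f′ i i′ (po-mediate po po′)
  po-cancel {f = f} {g} {i} {j} {f′} {i′} {j′} po po′ = record
    { commute    = ≈-sym (L.universal₁ _)
    ; universal  = λ eq → B.universal (out eq)
    ; universal₁ = λ eq → B.universal₁ (out eq)
    ; universal₂ = λ eq → po-unique po
        (≈-trans (pullˡ (L.universal₁ _)) (≈-trans (pullʳ (B.universal₁ (out eq))) eq))
        (≈-trans (pullˡ (L.universal₂ _)) (B.universal₂ (out eq)))
    ; unique     = λ eq a b → B.unique (out eq) a
        (≈-trans (⨾-congʳ (≈-sym (L.universal₂ _))) (pullʳ b))
    } where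
      module L = IsPushout po
      module B = IsPushout po′
      out : ∀ {X} {h : Hom _ X} {k : Hom _ X} → f′ ⨾ h ≈ i ⨾ k → (f ⨾ f′) ⨾ h ≈ g ⨾ (j ⨾ k)
      out eq = ≈-trans (pullʳ eq) (≈-trans (pullˡ L.commute) assoc)

  po-opposite-isos : ∀ {Y N M P} {f : Hom Y N} {g : Hom Y M} {i : Hom N P} {j : Hom M P} →
                     f ⨾ i ≈ g ⨾ j → IsIso g → IsIso i → IsPushout f g i j
  po-opposite-isos {f = f} {g} {i} {j} com u v = record
    { commute    = com
    ; universal  = λ {X} {h} {k} eq → V.inv ⨾ h
    ; universal₁ = λ eq → cancelˡ V.invʳ
    ; universal₂ = λ eq → ≈-trans (pullˡ (transpose u v (≈-sym com)))
                            (≈-trans (pullʳ eq) (cancelˡ U.invˡ))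
    ; unique     = λ eq a b → ≈-trans (≈-sym (cancelˡ V.invˡ)) (⨾-congˡ a)
    } where module U = IsIso u
            module V = IsIso v

  po-resp : ∀ {Y N M N′ M′ P} {f : Hom Y N} {g : Hom Y M} {f′ : Hom Y N′} {g′ : Hom Y M′}
            {i : Hom N′ P} {j : Hom M′ P} {u : Hom N N′} {v : Hom M M′} →
            IsIso u → IsIso v → f ⨾ u ≈ f′ → g ⨾ v ≈ g′ →
            IsPushout f′ g′ i j → IsPushout f g (u ⨾ i) (v ⨾ j)
  po-resp {f = f} {g} {f′} {g′} {i} {j} {u} {v} u-iso v-iso p q po = record
    { commute    = ≈-trans (pullˡ p) (≈-trans commute (≈-sym (pullˡ q)))
    ; universal  = λ eq → universal (out eq)
    ; universal₁ = λ eq → ≈-trans (pullʳ (universal₁ (out eq))) (cancelˡ U.invʳ)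
    ; universal₂ = λ eq → ≈-trans (pullʳ (universal₂ (out eq))) (cancelˡ V.invʳ)
    ; unique     = λ eq a b → unique (out eq)
        (≈-trans (≈-sym (cancelˡ U.invˡ)) (⨾-congˡ (≈-trans (≈-sym assoc) a)))
        (≈-trans (≈-sym (cancelˡ V.invˡ)) (⨾-congˡ (≈-trans (≈-sym assoc) b)))
    } where
      open IsPushout po
      module U = IsIso u-iso
      module V = IsIso v-iso
      out : ∀ {X} {h : Hom _ X} {k : Hom _ X} → f ⨾ h ≈ g ⨾ k →
            f′ ⨾ (U.inv ⨾ h) ≈ g′ ⨾ (V.inv ⨾ k)
      out eq = ≈-trans (⨾-congʳ (≈-sym p))
        (≈-trans (pullʳ (cancelˡ U.invʳ))
        (≈-trans eq
        (≈-sym (≈-trans (⨾-congʳ (≈-sym q)) (pullʳ (cancelˡ V.invʳ))))))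

  po-idˡ : ∀ {Y M} {g : Hom Y M} → IsPushout id g g id
  po-idˡ = po-swap (po-opposite-isos (≈-trans identityʳ (≈-sym identityˡ)) id-iso id-iso)

  po-≈ : ∀ {Y N M P} {f f′ : Hom Y N} {g g′ : Hom Y M} {i : Hom N P} {j : Hom M P} →
         f ≈ f′ → g ≈ g′ → IsPushout f′ g′ i j → IsPushout f g i j
  po-≈ p q po = record
    { commute    = ≈-trans (⨾-congʳ p) (≈-trans commute (⨾-congʳ (≈-sym q)))
    ; universal  = λ eq → universal (out eq)
    ; universal₁ = λ eq → universal₁ (out eq)
    ; universal₂ = λ eq → universal₂ (out eq)
    ; unique     = λ eq → unique (out eq)
    } where
      open IsPushout po
      out : ∀ {X} {h : Hom _ X} {k : Hom _ X} → _ ⨾ h ≈ _ ⨾ k → _ ⨾ h ≈ _ ⨾ k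
      out eq = ≈-trans (⨾-congʳ (≈-sym p)) (≈-trans eq (⨾-congʳ q))

  po-precompose : ∀ {Y Y′ N M P} {f : Hom Y N} {g : Hom Y M} {f′ : Hom Y′ N} {g′ : Hom Y′ M}
                  {i : Hom N P} {j : Hom M P} (u : Hom Y′ Y) (v : Hom Y Y′) → v ⨾ u ≈ id →
                  u ⨾ f ≈ f′ → u ⨾ g ≈ g′ → IsPushout f′ g′ i j → IsPushout f g i j
  po-precompose {f = f} {g} {f′} {g′} u v vu p q po = record
    { commute    = ≈-trans (⨾-congʳ (≈-sym p′)) (≈-trans (pullʳ commute)
                     (≈-trans (≈-sym assoc) (⨾-congʳ q′)))
    ; universal  = λ eq → universal (out eq)
    ; universal₁ = λ eq → universal₁ (out eq)
    ; universal₂ = λ eq → universal₂ (out eq)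
    ; unique     = λ eq → unique (out eq)
    } where
      open IsPushout po
      p′ : v ⨾ f′ ≈ f
      p′ = ≈-trans (⨾-congˡ (≈-sym p)) (cancelˡ vu)
      q′ : v ⨾ g′ ≈ g
      q′ = ≈-trans (⨾-congˡ (≈-sym q)) (cancelˡ vu)
      out : ∀ {X} {h : Hom _ X} {k : Hom _ X} → f ⨾ h ≈ g ⨾ k → f′ ⨾ h ≈ g′ ⨾ k
      out eq = ≈-trans (⨾-congʳ (≈-sym p)) (≈-trans (pullʳ eq) (≈-trans (≈-sym assoc) (⨾-congʳ q)))

  -- For spans X ← N → Y and Y ← M → Z, and a span N ← P → M over Y: the pushout R
  -- of their pushouts S and T is obtained from the pushout W of X ← P → Z by pushing
  -- out along the morphism to Y from the pushout V of N ← P → M.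
  po-fold : ∀ {X Y Z N M P S T R V W}
            {f : Hom N X} {g : Hom N Y} {h : Hom M Y} {k : Hom M Z}
            {p : Hom P N} {q : Hom P M}
            {i₁ : Hom X S} {j₁ : Hom Y S} {i₂ : Hom Y T} {j₂ : Hom Z T}
            {r₁ : Hom S R} {r₂ : Hom T R} {a : Hom X W} {b : Hom Z W}
            {y₁ : Hom N V} {y₂ : Hom M V} {v : Hom V Y} {z : Hom V W} {w : Hom W R} →
            IsPushout f g i₁ j₁ → IsPushout h k i₂ j₂ → IsPushout j₁ i₂ r₁ r₂ →
            IsPushout (p ⨾ f) (q ⨾ k) a b → IsPushout p q y₁ y₂ →
            y₁ ⨾ v ≈ g → y₂ ⨾ v ≈ h → y₁ ⨾ z ≈ f ⨾ a → y₂ ⨾ z ≈ k ⨾ b →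
            a ⨾ w ≈ i₁ ⨾ r₁ → b ⨾ w ≈ j₂ ⨾ r₂ →
            IsPushout v z (j₁ ⨾ r₁) w
  po-fold {f = f} {g} {h} {k} {p} {q} {i₁} {j₁} {i₂} {j₂} {r₁} {r₂} {a} {b} {y₁} {y₂} {v} {z} {w}
          poS poT poR poW poV y₁v y₂v y₁z y₂z aw bw = record
    { commute    = po-unique poV
        (≈-trans (pullˡ y₁v) (≈-trans (pullˡ (≈-sym S.commute)) (≈-trans (pullʳ (≈-sym aw))
          (≈-sym (≈-trans (pullˡ y₁z) assoc)))))
        (≈-trans (pullˡ y₂v) (≈-trans (⨾-congˡ R.commute) (≈-trans (pullˡ T.commute)
          (≈-trans (pullʳ (≈-sym bw)) (≈-sym (≈-trans (pullˡ y₂z) assoc))))))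
    ; universal  = λ eq → fromR eq
    ; universal₁ = λ eq → ≈-trans (pullʳ (R.universal₁ _)) (S.universal₂ _)
    ; universal₂ = λ eq → po-unique poW
        (≈-trans (pullˡ aw) (≈-trans (pullʳ (R.universal₁ _)) (S.universal₁ _)))
        (≈-trans (pullˡ bw) (≈-trans (pullʳ (R.universal₂ _)) (T.universal₂ _)))
    ; unique     = λ eq c d → po-unique poR
        (≈-trans (po-unique poS
          (≈-trans (pullˡ (≈-sym aw)) (≈-trans (pullʳ d) (≈-sym (S.universal₁ _))))
          (≈-trans (≈-sym assoc) (≈-trans c (≈-sym (S.universal₂ _)))))
          (≈-sym (R.universal₁ _)))
        (≈-trans (po-unique poT
          (≈-trans (pullˡ (≈-sym R.commute)) (≈-trans c (≈-sym (T.universal₁ _))))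
          (≈-trans (pullˡ (≈-sym bw)) (≈-trans (pullʳ d) (≈-sym (T.universal₂ _)))))
          (≈-sym (R.universal₂ _)))
    } where
    module S = IsPushout poS
    module T = IsPushout poT
    module R = IsPushout poR
    fromS : ∀ {X} {c : Hom _ X} {d : Hom _ X} → v ⨾ c ≈ z ⨾ d → Hom _ X
    fromS {c = c} {d} eq = S.universal {h = a ⨾ d} {k = c}
      (≈-trans (pullˡ (≈-sym y₁z)) (≈-trans (pullʳ (≈-sym eq)) (pullˡ y₁v)))
    fromT : ∀ {X} {c : Hom _ X} {d : Hom _ X} → v ⨾ c ≈ z ⨾ d → Hom _ X
    fromT {c = c} {d} eq = T.universal {h = c} {k = b ⨾ d}
      (≈-trans (⨾-congʳ (≈-sym y₂v)) (≈-trans (pullʳ eq) (≈-trans (pullˡ y₂z) assoc)))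
    fromR : ∀ {X} {c : Hom _ X} {d : Hom _ X} → v ⨾ c ≈ z ⨾ d → Hom _ X
    fromR eq = R.universal {h = fromS eq} {k = fromT eq}
      (≈-trans (S.universal₂ _) (≈-sym (T.universal₁ _)))

module PropLemmas (P : PropCategory ℓ) where
  open PropCategory P
  open CategoryLemmas category

  σ-iso : ∀ {m n} → IsIso (σ m n)
  σ-iso {m} {n} = record { inv = σ n m ; invʳ = σ-involutive ; invˡ = σ-involutive }

  ⊗-inverse : ∀ {m n m′ n′} {f : Hom m n} {g : Hom n m} {f′ : Hom m′ n′} {g′ : Hom n′ m′} →
              f ⨾ g ≈ id → f′ ⨾ g′ ≈ id → (f ⊗ f′) ⨾ (g ⊗ g′) ≈ id
  ⊗-inverse p q = ≈-trans (≈-sym ⊗-⨾) (≈-trans (⊗-cong p q) ⊗-id)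

  ⊗-iso : ∀ {m n m′ n′} {f : Hom m n} {f′ : Hom m′ n′} →
          IsIso f → IsIso f′ → IsIso (f ⊗ f′)
  ⊗-iso u v = record
    { inv  = IsIso.inv u ⊗ IsIso.inv v
    ; invʳ = ⊗-inverse (IsIso.invʳ u) (IsIso.invʳ v)
    ; invˡ = ⊗-inverse (IsIso.invˡ u) (IsIso.invˡ v)
    }

oppositeProp : PropCategory ℓ → PropCategory ℓ
oppositeProp P = record
  { category     = opposite category
  ; _⊗_          = _⊗_
  ; ⊗-cong       = ⊗-cong
  ; ⊗-id         = ⊗-id
  ; ⊗-⨾          = ⊗-⨾
  ; ⊗-assoc      = λ {m} {n} {m′} {n′} {m″} {n″} →
      coe-transpose (+-assoc n n′ n″) (+-assoc m m′ m″) ⊗-assoc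
  ; ⊗-identityˡ  = ⊗-identityˡ
  ; ⊗-identityʳ  = λ {m} {n} → coe-transpose (+-identityʳ n) (+-identityʳ m) ⊗-identityʳ
  ; σ            = λ m n → σ n m
  ; σ-natural    = ≈-sym σ-natural
  ; σ-involutive = σ-involutive
  ; σ-hexagon    = λ {m} {n} {k} → hexagon m n k
  } where
  open PropCategory P
  open CategoryLemmas category
  open PropLemmas P

  coeᵒ : ∀ {m n} → m ≡ n → Hom n m
  coeᵒ = Category.coe (opposite category)

  coeᵒ≈ : ∀ {m n} (e : m ≡ n) → coeᵒ e ≈ coe (≡.sym e)
  coeᵒ≈ ≡.refl = ≈-refl

  coe-transpose : ∀ {m m′ n n′} (e : n ≡ n′) (d : m ≡ m′) {f : Hom n m} {g : Hom n′ m′} →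
                  f ⨾ coe d ≈ coe e ⨾ g → coeᵒ e ⨾ f ≈ g ⨾ coeᵒ d
  coe-transpose ≡.refl ≡.refl p =
    ≈-trans identityˡ (≈-trans (≈-sym identityʳ)
    (≈-trans p (≈-trans identityˡ (≈-sym identityʳ))))

  hexagon : ∀ m n k →
    (coeᵒ (+-assoc n k m) ⨾ σ (n + k) m) ⨾ coeᵒ (+-assoc m n k) ≈
    ((id {n} ⊗ σ k m) ⨾ coeᵒ (+-assoc n m k)) ⨾ (σ n m ⊗ id)
  hexagon m n k = inv-unique lhs (≈-trans (⨾-congʳ σ-hexagon) rhs)
    where
    cancel-coe : ∀ {m n} (e : m ≡ n) → coe e ⨾ coeᵒ e ≈ id
    cancel-coe ≡.refl = identityˡ
    cancel-coe′ : ∀ {m n} (e : m ≡ n) → coeᵒ e ⨾ coe e ≈ id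
    cancel-coe′ ≡.refl = identityˡ
    lhs : ((coeᵒ (+-assoc n k m) ⨾ σ (n + k) m) ⨾ coeᵒ (+-assoc m n k)) ⨾
          (coe (+-assoc m n k) ⨾ σ m (n + k) ⨾ coe (+-assoc n k m)) ≈ id
    lhs = ≈-trans (pullʳ (cancelˡ (cancel-coe′ (+-assoc m n k))))
         (≈-trans (pullʳ (cancelˡ σ-involutive)) (cancel-coe′ (+-assoc n k m)))
    rhs : ((σ m n ⊗ id) ⨾ coe (+-assoc n m k) ⨾ (id {n} ⊗ σ m k)) ⨾
          (((id {n} ⊗ σ k m) ⨾ coeᵒ (+-assoc n m k)) ⨾ (σ n m ⊗ id)) ≈ id
    rhs = ≈-trans (≈-sym assoc) (≈-trans (⨾-congʳ
            (≈-trans (pullʳ (≈-trans (pullʳ (cancelˡ (⊗-inverse identityˡ σ-involutive)))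
                                     (cancel-coe (+-assoc n m k)))) identityʳ))
            (⊗-inverse σ-involutive identityˡ))

------------------------------------------------------------------------

record SubProp (P : PropCategory ℓ) : Set (suc ℓ) where
  open PropCategory P
  field
    member   : MorphismClass
    resp-≈   : ∀ {m n} {f g : Hom m n} → f ≈ g → member f → member g
    id∈      : ∀ {n} → member (id {n})
    ⨾-closed : ∀ {m n k} {f : Hom m n} {g : Hom n k} → member f → member g → member (f ⨾ g)
    ⊗-closed : ∀ {m n m′ n′} {f : Hom m n} {g : Hom m′ n′} →
               member f → member g → member (f ⊗ g)
    σ∈       : ∀ {m n} → member (σ m n)

  coe∈ : ∀ {m n} (e : m ≡ n) → member (coe e)
  coe∈ ≡.refl = id∈

  private
    cat : Category _ ℕ
    cat = record
      { Hom           = λ m n → Σ[ f ∈ Hom m n ] member f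
      ; _≈_           = λ f g → proj₁ f ≈ proj₁ g
      ; isEquivalence = record { refl = ≈-refl ; sym = ≈-sym ; trans = ≈-trans }
      ; id            = id , id∈
      ; _⨾_           = λ (f , f∈) (g , g∈) → f ⨾ g , ⨾-closed f∈ g∈
      ; ⨾-cong        = ⨾-cong
      ; assoc         = assoc
      ; identityˡ     = identityˡ
      ; identityʳ     = identityʳ
      }

    coe₁ : ∀ {m n} (e : m ≡ n) → proj₁ (Category.coe cat e) ≈ coe e
    coe₁ ≡.refl = ≈-refl

    coe-square : ∀ {m m′ n n′} (e : n ≡ n′) (d : m ≡ m′) {f : Hom m n} {g : Hom m′ n′} →
                 f ⨾ coe e ≈ coe d ⨾ g →
                 f ⨾ proj₁ (Category.coe cat e) ≈ proj₁ (Category.coe cat d) ⨾ g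
    coe-square e d p =
      ≈-trans (⨾-congˡ (coe₁ e)) (≈-trans p (⨾-congʳ (≈-sym (coe₁ d))))

  toProp : PropCategory ℓ
  toProp = record
    { category     = cat
    ; _⊗_          = λ (f , f∈) (g , g∈) → f ⊗ g , ⊗-closed f∈ g∈
    ; ⊗-cong       = ⊗-cong
    ; ⊗-id         = ⊗-id
    ; ⊗-⨾          = ⊗-⨾
    ; ⊗-assoc      = λ {m} {n} {m′} {n′} {m″} {n″} →
        coe-square (+-assoc n n′ n″) (+-assoc m m′ m″) ⊗-assoc
    ; ⊗-identityˡ  = ⊗-identityˡ
    ; ⊗-identityʳ  = λ {m} {n} → coe-square (+-identityʳ n) (+-identityʳ m) ⊗-identityʳ
    ; σ            = λ m n → σ m n , σ∈
    ; σ-natural    = σ-natural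
    ; σ-involutive = σ-involutive
    ; σ-hexagon    = λ {m} {n} {k} → ≈-trans
        (⨾-cong (coe₁ (+-assoc m n k)) (⨾-congˡ (coe₁ (+-assoc n k m))))
        (≈-trans σ-hexagon (⨾-congˡ (⨾-congʳ (≈-sym (coe₁ (+-assoc n m k))))))
    }

whole : (P : PropCategory ℓ) → SubProp P
whole P = record
  { member   = λ _ → ⊤
  ; resp-≈   = λ _ _ → _
  ; id∈      = _
  ; ⨾-closed = λ _ _ → _
  ; ⊗-closed = λ _ _ → _
  ; σ∈       = _
  }

oppositeSub : {P : PropCategory ℓ} → SubProp P → SubProp (oppositeProp P)
oppositeSub A = record
  { member   = member
  ; resp-≈   = resp-≈
  ; id∈      = id∈
  ; ⨾-closed = λ f∈ g∈ → ⨾-closed g∈ f∈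
  ; ⊗-closed = ⊗-closed
  ; σ∈       = σ∈
  } where open SubProp A

------------------------------------------------------------------------

record Cospan {P : PropCategory ℓ} (L : SubProp P) (m n : ℕ) : Set ℓ where
  constructor cospan
  open PropCategory P
  field
    {apex} : ℕ
    left   : Hom m apex
    right  : Hom n apex
    left∈  : SubProp.member L left
    right∈ : SubProp.member L right

infix 4 _≅_

record _≅_ {P : PropCategory ℓ} {L : SubProp P} {m n : ℕ} (c d : Cospan L m n) : Set ℓ where
  open PropCategory P
  private
    module c = Cospan c
    module d = Cospan d
  field
    iso   : Hom c.apex d.apex
    isIso : IsIso iso
    left  : c.left ⨾ iso ≈ d.left
    right : c.right ⨾ iso ≈ d.right

module _ {P : PropCategory ℓ} (L : SubProp P) where
  open PropCategory P
  open SubProp L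

  ⊗-PreservesPushouts : Set ℓ
  ⊗-PreservesPushouts =
    ∀ {Y N M Q Y′ N′ M′ Q′}
      {f : Hom Y N} {g : Hom Y M} {i : Hom N Q} {j : Hom M Q}
      {f′ : Hom Y′ N′} {g′ : Hom Y′ M′} {i′ : Hom N′ Q′} {j′ : Hom M′ Q′} →
    member f → member g → member f′ → member g′ →
    IsPushout f g i j → IsPushout f′ g′ i′ j′ →
    IsPushout (f ⊗ f′) (g ⊗ g′) (i ⊗ i′) (j ⊗ j′)

-- Spans with legs in A are the case of the opposite prop and oppositeSub A.

module CospanProp
  {P : PropCategory ℓ} (L : SubProp P)
  (pushouts  : PropCategory.HasPushouts P)
  (stable    : StableUnderPushout (PropCategory.category P) (SubProp.member L))
  (⊗-pushout : ⊗-PreservesPushouts L)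
  where

  open PropCategory P
  open SubProp L
  open CategoryLemmas category
  open PushoutLemmas category
  open PropLemmas P

  private
    module Po {Y N M} {f : Hom Y N} {g : Hom Y M} where
      open Pushout (pushouts f g) public
      open IsPushout isPushout public

  ≅-refl : ∀ {m n} {c : Cospan L m n} → c ≅ c
  ≅-refl = record { isIso = id-iso ; left = identityʳ ; right = identityʳ }

  ≅-sym : ∀ {m n} {c d : Cospan L m n} → c ≅ d → d ≅ c
  ≅-sym u = record
    { isIso = inv-iso U.isIso
    ; left  = ≈-trans (⨾-congʳ (≈-sym U.left)) (cancelʳ (IsIso.invʳ U.isIso))
    ; right = ≈-trans (⨾-congʳ (≈-sym U.right)) (cancelʳ (IsIso.invʳ U.isIso))
    } where module U = _≅_ u

  ≅-trans : ∀ {m n} {c d e : Cospan L m n} → c ≅ d → d ≅ e → c ≅ e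
  ≅-trans u v = record
    { isIso = ⨾-iso U.isIso V.isIso
    ; left  = ≈-trans (pullˡ U.left) V.left
    ; right = ≈-trans (pullˡ U.right) V.right
    } where module U = _≅_ u
            module V = _≅_ v

  ≅-legs : ∀ {m n k} {f f′ : Hom m k} {g g′ : Hom n k}
           {f∈ : member f} {f′∈ : member f′} {g∈ : member g} {g′∈ : member g′} →
           f ≈ f′ → g ≈ g′ → cospan {L = L} f g f∈ g∈ ≅ cospan f′ g′ f′∈ g′∈
  ≅-legs p q = record
    { isIso = id-iso ; left = ≈-trans identityʳ p ; right = ≈-trans identityʳ q }

  idᶜ : ∀ {n} → Cospan L n n
  idᶜ = cospan id id id∈ id∈

  infixr 9 _⨾ᶜ_
  infixr 10 _⊗ᶜ_

  _⨾ᶜ_ : ∀ {m n k} → Cospan L m n → Cospan L n k → Cospan L m k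
  c ⨾ᶜ d = record
    { left   = c.left ⨾ in₁
    ; right  = d.right ⨾ in₂
    ; left∈  = ⨾-closed c.left∈ (stable (po-swap isPushout) d.left∈)
    ; right∈ = ⨾-closed d.right∈ (stable isPushout c.right∈)
    } where
      module c = Cospan c
      module d = Cospan d
      open Pushout (pushouts c.right d.left)

  _⊗ᶜ_ : ∀ {m n m′ n′} → Cospan L m n → Cospan L m′ n′ → Cospan L (m + m′) (n + n′)
  c ⊗ᶜ d = record
    { left   = c.left ⊗ d.left
    ; right  = c.right ⊗ d.right
    ; left∈  = ⊗-closed c.left∈ d.left∈
    ; right∈ = ⊗-closed c.right∈ d.right∈
    } where
      module c = Cospan c
      module d = Cospan d

  ⨾ᶜ-via : ∀ {m n k} (c : Cospan L m n) (d : Cospan L n k) (e : Cospan L m k)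
           {i : Hom (Cospan.apex c) (Cospan.apex e)} {j : Hom (Cospan.apex d) (Cospan.apex e)} →
           IsPushout (Cospan.right c) (Cospan.left d) i j →
           Cospan.left c ⨾ i ≈ Cospan.left e → Cospan.right d ⨾ j ≈ Cospan.right e →
           c ⨾ᶜ d ≅ e
  ⨾ᶜ-via c d e po p q = record
    { isIso = po-iso Q.isPushout po
    ; left  = ≈-trans (pullʳ (universal₁ _)) p
    ; right = ≈-trans (pullʳ (universal₂ _)) q
    } where
      module Q = Pushout (pushouts (Cospan.right c) (Cospan.left d))
      open IsPushout Q.isPushout

  ⨾ᶜ-cong : ∀ {m n k} {c c′ : Cospan L m n} {d d′ : Cospan L n k} →
            c ≅ c′ → d ≅ d′ → c ⨾ᶜ d ≅ c′ ⨾ᶜ d′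
  ⨾ᶜ-cong {c = c} {c′} {d} {d′} u v =
    ⨾ᶜ-via c d (c′ ⨾ᶜ d′)
      (po-resp U.isIso V.isIso U.right V.left
        (Pushout.isPushout (pushouts (Cospan.right c′) (Cospan.left d′))))
      (pullˡ U.left) (pullˡ V.right)
    where module U = _≅_ u
          module V = _≅_ v

  ⨾ᶜ-assoc : ∀ {m n k l} {c : Cospan L m n} {d : Cospan L n k} {e : Cospan L k l} →
             (c ⨾ᶜ d) ⨾ᶜ e ≅ c ⨾ᶜ (d ⨾ᶜ e)
  ⨾ᶜ-assoc {c = c} {d} {e} = ≅-sym (⨾ᶜ-via c (d ⨾ᶜ e) ((c ⨾ᶜ d) ⨾ᶜ e)
    (po-swap (po-paste (po-swap A.isPushout) (po-swap (po-cancel B.isPushout R.isPushout))))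
    (≈-sym assoc)
    (pullʳ (IsPushout.universal₂ B.isPushout _)))
    where
      module c = Cospan c
      module d = Cospan d
      module e = Cospan e
      module A = Pushout (pushouts c.right d.left)
      module B = Pushout (pushouts d.right e.left)
      module R = Pushout (pushouts (d.right ⨾ A.in₂) e.left)

  ⨾ᶜ-identityˡ : ∀ {m n} {c : Cospan L m n} → idᶜ ⨾ᶜ c ≅ c
  ⨾ᶜ-identityˡ {c = c} = ⨾ᶜ-via idᶜ c c po-idˡ identityˡ identityʳ

  ⨾ᶜ-identityʳ : ∀ {m n} {c : Cospan L m n} → c ⨾ᶜ idᶜ ≅ c
  ⨾ᶜ-identityʳ {c = c} = ⨾ᶜ-via c idᶜ c (po-swap po-idˡ) identityʳ identityˡ

  category′ : Category ℓ ℕ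
  category′ = record
    { Hom           = Cospan L
    ; _≈_           = _≅_
    ; isEquivalence = record { refl = ≅-refl ; sym = ≅-sym ; trans = ≅-trans }
    ; id            = idᶜ
    ; _⨾_           = _⨾ᶜ_
    ; ⨾-cong        = ⨾ᶜ-cong
    ; assoc         = λ {_} {_} {_} {_} {c} {d} {e} → ⨾ᶜ-assoc {c = c} {d} {e}
    ; identityˡ     = ⨾ᶜ-identityˡ
    ; identityʳ     = ⨾ᶜ-identityʳ
    }

  ⊗ᶜ-cong : ∀ {m n m′ n′} {c d : Cospan L m n} {c′ d′ : Cospan L m′ n′} →
            c ≅ d → c′ ≅ d′ → c ⊗ᶜ c′ ≅ d ⊗ᶜ d′
  ⊗ᶜ-cong u v = record
    { isIso = ⊗-iso U.isIso V.isIso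
    ; left  = ≈-trans (≈-sym ⊗-⨾) (⊗-cong U.left V.left)
    ; right = ≈-trans (≈-sym ⊗-⨾) (⊗-cong U.right V.right)
    } where module U = _≅_ u
            module V = _≅_ v

  ⊗ᶜ-⨾ᶜ : ∀ {m n k m′ n′ k′} {c : Cospan L m n} {d : Cospan L n k}
          {c′ : Cospan L m′ n′} {d′ : Cospan L n′ k′} →
          (c ⨾ᶜ d) ⊗ᶜ (c′ ⨾ᶜ d′) ≅ (c ⊗ᶜ c′) ⨾ᶜ (d ⊗ᶜ d′)
  ⊗ᶜ-⨾ᶜ {c = c} {d} {c′} {d′} =
    ≅-sym (⨾ᶜ-via (c ⊗ᶜ c′) (d ⊗ᶜ d′) ((c ⨾ᶜ d) ⊗ᶜ (c′ ⨾ᶜ d′))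
      (⊗-pushout (Cospan.right∈ c) (Cospan.left∈ d) (Cospan.right∈ c′) (Cospan.left∈ d′)
        (Pushout.isPushout (pushouts _ _)) (Pushout.isPushout (pushouts _ _)))
      (≈-sym ⊗-⨾) (≈-sym ⊗-⨾))

  forward : ∀ {m n} (f : Hom m n) → member f → Cospan L m n
  forward f f∈ = cospan f id f∈ id∈

  backward : ∀ {m n} (f : Hom m n) → member f → Cospan L n m
  backward f f∈ = cospan id f id∈ f∈

  forward-⨾ᶜ : ∀ {m n k} {f : Hom m n} (f∈ : member f) (c : Cospan L n k) →
               forward f f∈ ⨾ᶜ c ≅
               cospan (f ⨾ Cospan.left c) (Cospan.right c)
                      (⨾-closed f∈ (Cospan.left∈ c)) (Cospan.right∈ c)
  forward-⨾ᶜ f∈ c = ⨾ᶜ-via (forward _ f∈) c _ po-idˡ ≈-refl identityʳ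

  -- A morphism of cospans (w), carried by b and a on the feet.
  square : ∀ {m n m′ n′} (c : Cospan L m n) (d : Cospan L m′ n′)
           {b : Hom m m′} {a : Hom n n′} {w : Hom (Cospan.apex c) (Cospan.apex d)}
           (b∈ : member b) (a∈ : member a) → IsIso a → IsIso w →
           Cospan.left c ⨾ w ≈ b ⨾ Cospan.left d → Cospan.right c ⨾ w ≈ a ⨾ Cospan.right d →
           c ⨾ᶜ forward a a∈ ≅ forward b b∈ ⨾ᶜ d
  square c d b∈ a∈ a-iso w-iso p q = ≅-trans
    (⨾ᶜ-via c (forward _ a∈) _ (po-opposite-isos q a-iso w-iso) p identityˡ)
    (≅-sym (forward-⨾ᶜ b∈ d))

  forward-⊗ᶜ : ∀ {m n m′ n′} {f : Hom m n} {f′ : Hom m′ n′}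
               {f∈ : member f} {f′∈ : member f′} {f⊗f′∈ : member (f ⊗ f′)} →
               forward (f ⊗ f′) f⊗f′∈ ≅ forward f f∈ ⊗ᶜ forward f′ f′∈
  forward-⊗ᶜ = ≅-legs ≈-refl (≈-sym ⊗-id)

  backward-⊗ᶜ : ∀ {m n m′ n′} {f : Hom m n} {f′ : Hom m′ n′}
                {f∈ : member f} {f′∈ : member f′} {f⊗f′∈ : member (f ⊗ f′)} →
                backward (f ⊗ f′) f⊗f′∈ ≅ backward f f∈ ⊗ᶜ backward f′ f′∈
  backward-⊗ᶜ = ≅-legs (≈-sym ⊗-id) ≈-refl

  forward-⨾ : ∀ {m n k} {f : Hom m n} {g : Hom n k}
              {f∈ : member f} {g∈ : member g} {fg∈ : member (f ⨾ g)} →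
              forward (f ⨾ g) fg∈ ≅ forward f f∈ ⨾ᶜ forward g g∈
  forward-⨾ = ≅-sym (≅-trans (forward-⨾ᶜ _ (forward _ _)) (≅-legs ≈-refl ≈-refl))

  backward-⨾ : ∀ {m n k} {f : Hom m n} {g : Hom n k}
               {f∈ : member f} {g∈ : member g} {fg∈ : member (f ⨾ g)} →
               backward (f ⨾ g) fg∈ ≅ backward g g∈ ⨾ᶜ backward f f∈
  backward-⨾ = ≅-sym (⨾ᶜ-via (backward _ _) (backward _ _) (backward _ _)
                        (po-swap po-idˡ) identityˡ ≈-refl)

  coeᶜ : ∀ {m n} (e : m ≡ n) → Category.coe category′ e ≅ forward (coe e) (coe∈ e)
  coeᶜ ≡.refl = ≅-refl

  coe-square : ∀ {m n m′ n′} (c : Cospan L m n) (d : Cospan L m′ n′)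
               (e : n ≡ n′) (e′ : m ≡ m′) (e″ : Cospan.apex c ≡ Cospan.apex d) →
               Cospan.left c ⨾ coe e″ ≈ coe e′ ⨾ Cospan.left d →
               Cospan.right c ⨾ coe e″ ≈ coe e ⨾ Cospan.right d →
               c ⨾ᶜ Category.coe category′ e ≅ Category.coe category′ e′ ⨾ᶜ d
  coe-square c d e e′ e″ p q = ≅-trans (⨾ᶜ-cong {c = c} ≅-refl (coeᶜ e))
    (≅-trans (square c d (coe∈ e′) (coe∈ e) (coe-iso e) (coe-iso e″) p q)
             (⨾ᶜ-cong {d = d} (≅-sym (coeᶜ e′)) ≅-refl))

  σᶜ : ∀ m n → Cospan L (m + n) (n + m)
  σᶜ m n = forward (σ m n) σ∈

  σᶜ-hexagon : ∀ m n k →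
    Category.coe category′ (+-assoc m n k) ⨾ᶜ σᶜ m (n + k) ⨾ᶜ Category.coe category′ (+-assoc n k m) ≅
    (σᶜ m n ⊗ᶜ idᶜ) ⨾ᶜ Category.coe category′ (+-assoc n m k) ⨾ᶜ (idᶜ {n} ⊗ᶜ σᶜ m k)
  σᶜ-hexagon m n k = ≅-trans
    (⨾ᶜ-cong (coeᶜ (+-assoc m n k)) (⨾ᶜ-cong ≅-refl (coeᶜ (+-assoc n k m))))
    (≅-trans (⨾ᶜ-cong ≅-refl (≅-sym (forward-⨾ {fg∈ = ⨾-closed σ∈ b})))
    (≅-trans (≅-sym (forward-⨾ {fg∈ = ⨾-closed a (⨾-closed σ∈ b)}))
    (≅-trans (≅-legs {f′∈ = ⨾-closed (⊗-closed σ∈ id∈) (⨾-closed d (⊗-closed id∈ σ∈))}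
                     {g′∈ = id∈} σ-hexagon ≈-refl)
    (≅-trans (forward-⨾ {f∈ = ⊗-closed σ∈ id∈} {g∈ = ⨾-closed d (⊗-closed id∈ σ∈)})
    (≅-trans (⨾ᶜ-cong ≅-refl (forward-⨾ {f∈ = d} {g∈ = ⊗-closed id∈ σ∈}))
    (⨾ᶜ-cong forward-⊗ᶜ (⨾ᶜ-cong (≅-sym (coeᶜ (+-assoc n m k))) forward-⊗ᶜ)))))))
    where
    a = coe∈ (+-assoc m n k)
    b = coe∈ (+-assoc n k m)
    d = coe∈ (+-assoc n m k)

  prop : PropCategory ℓ
  prop = record
    { category     = category′
    ; _⊗_          = _⊗ᶜ_
    ; ⊗-cong       = ⊗ᶜ-cong
    ; ⊗-id         = ≅-legs ⊗-id ⊗-id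
    ; ⊗-⨾          = λ {_} {_} {_} {_} {_} {_} {c} {d} {c′} {d′} → ⊗ᶜ-⨾ᶜ {c = c} {d} {c′} {d′}
    ; ⊗-assoc      = λ {m} {n} {m′} {n′} {m″} {n″} {c} {c′} {c″} →
        coe-square ((c ⊗ᶜ c′) ⊗ᶜ c″) (c ⊗ᶜ (c′ ⊗ᶜ c″)) (+-assoc n n′ n″) (+-assoc m m′ m″)
          (+-assoc (Cospan.apex c) (Cospan.apex c′) (Cospan.apex c″)) ⊗-assoc ⊗-assoc
    ; ⊗-identityˡ  = ≅-legs ⊗-identityˡ ⊗-identityˡ
    ; ⊗-identityʳ  = λ {m} {n} {c} → coe-square (c ⊗ᶜ idᶜ) c (+-identityʳ n) (+-identityʳ m)
          (+-identityʳ (Cospan.apex c)) ⊗-identityʳ ⊗-identityʳ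
    ; σ            = σᶜ
    ; σ-natural    = λ {_} {_} {_} {_} {c} {c′} →
        square (c ⊗ᶜ c′) (c′ ⊗ᶜ c) σ∈ σ∈ σ-iso σ-iso σ-natural σ-natural
    ; σ-involutive = ≅-trans (≅-sym (forward-⨾ {fg∈ = ⨾-closed σ∈ σ∈}))
                             (≅-legs σ-involutive ≈-refl)
    ; σ-hexagon    = λ {m} {n} {k} → σᶜ-hexagon m n k
    }

  forwardFunctor : PropFunctor toProp prop
  forwardFunctor = record
    { map      = λ (f , f∈) → forward f f∈
    ; map-cong = λ p → ≅-legs p ≈-refl
    ; map-id   = ≅-refl
    ; map-⨾    = forward-⨾
    ; map-⊗    = forward-⊗ᶜ
    ; map-σ    = ≅-refl
    }

  backwardFunctor : PropFunctor (oppositeProp toProp) prop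
  backwardFunctor = record
    { map      = λ (f , f∈) → backward f f∈
    ; map-cong = λ p → ≅-legs ≈-refl p
    ; map-id   = ≅-refl
    ; map-⨾    = backward-⨾
    ; map-⊗    = backward-⊗ᶜ
    ; map-σ    = record { isIso = σ-iso ; left = identityˡ ; right = σ-involutive }
    }

------------------------------------------------------------------------

-- Identifying morphisms of a prop along a congruence coarser than its equality.

module Quotient
  (P : PropCategory ℓ)
  (_~_     : ∀ {m n} → Rel (PropCategory.Hom P m n) ℓ)
  (equiv   : ∀ {m n} → IsEquivalence (_~_ {m} {n}))
  (coarser : ∀ {m n} {f g : PropCategory.Hom P m n} → PropCategory._≈_ P f g → f ~ g)
  (⨾-resp  : ∀ {m n k} {f f′ : PropCategory.Hom P m n} {g g′ : PropCategory.Hom P n k} →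
             f ~ f′ → g ~ g′ → PropCategory._⨾_ P f g ~ PropCategory._⨾_ P f′ g′)
  (⊗-resp  : ∀ {m n m′ n′} {f f′ : PropCategory.Hom P m n} {g g′ : PropCategory.Hom P m′ n′} →
             f ~ f′ → g ~ g′ → PropCategory._⊗_ P f g ~ PropCategory._⊗_ P f′ g′)
  where

  open PropCategory P

  private
    ~-refl : ∀ {m n} {f : Hom m n} → f ~ f
    ~-refl = IsEquivalence.refl equiv

    ~-trans : ∀ {m n} {f g h : Hom m n} → f ~ g → g ~ h → f ~ h
    ~-trans = IsEquivalence.trans equiv

    cat : Category ℓ ℕ
    cat = record
      { Hom           = Hom
      ; _≈_           = _~_
      ; isEquivalence = equiv
      ; id            = id
      ; _⨾_           = _⨾_
      ; ⨾-cong        = ⨾-resp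
      ; assoc         = coarser assoc
      ; identityˡ     = coarser identityˡ
      ; identityʳ     = coarser identityʳ
      }

    coe~ : ∀ {m n} (e : m ≡ n) → Category.coe cat e ≈ coe e
    coe~ ≡.refl = ≈-refl

    coe-square : ∀ {m m′ n n′} (e : n ≡ n′) (d : m ≡ m′) {f : Hom m n} {g : Hom m′ n′} →
                 f ⨾ coe e ≈ coe d ⨾ g → (f ⨾ Category.coe cat e) ~ (Category.coe cat d ⨾ g)
    coe-square e d p =
      coarser (≈-trans (⨾-congˡ (coe~ e)) (≈-trans p (⨾-congʳ (≈-sym (coe~ d)))))

  prop : PropCategory ℓ
  prop = record
    { category     = cat
    ; _⊗_          = _⊗_
    ; ⊗-cong       = ⊗-resp
    ; ⊗-id         = coarser ⊗-id
    ; ⊗-⨾          = coarser ⊗-⨾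
    ; ⊗-assoc      = λ {m} {n} {m′} {n′} {m″} {n″} →
        coe-square (+-assoc n n′ n″) (+-assoc m m′ m″) ⊗-assoc
    ; ⊗-identityˡ  = coarser ⊗-identityˡ
    ; ⊗-identityʳ  = λ {m} {n} → coe-square (+-identityʳ n) (+-identityʳ m) ⊗-identityʳ
    ; σ            = σ
    ; σ-natural    = coarser σ-natural
    ; σ-involutive = coarser σ-involutive
    ; σ-hexagon    = λ {m} {n} {k} → coarser (≈-trans
        (⨾-cong (coe~ (+-assoc m n k)) (⨾-congˡ (coe~ (+-assoc n k m))))
        (≈-trans σ-hexagon (⨾-congˡ (⨾-congʳ (≈-sym (coe~ (+-assoc n m k)))))))
    }

  quotientFunctor : PropFunctor P prop
  quotientFunctor = record
    { map      = λ f → f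
    ; map-cong = coarser
    ; map-id   = ~-refl
    ; map-⨾    = ~-refl
    ; map-⊗    = ~-refl
    ; map-σ    = ~-refl
    }

------------------------------------------------------------------------

-- Zigzags of morphisms of P and Q, composed by concatenation. Equality absorbs
-- identities and composable neighbours from the same side. As the coproduct is
-- taken among props, it also makes the two symmetries agree and the monoidal
-- product functorial.

module Coproduct (P Q : PropCategory ℓ) where

  private
    module P = PropCategory P
    module Q = PropCategory Q

  Step : ℕ → ℕ → Set ℓ
  Step m n = P.Hom m n ⊎ Q.Hom m n

  Zigzag : ℕ → ℕ → Set ℓ
  Zigzag = Star Step

  _▷_ : ∀ {m n} → Step m n → ∀ k → Step (m + k) (n + k)
  inj₁ f ▷ k = inj₁ (f P.⊗ P.id)
  inj₂ f ▷ k = inj₂ (f Q.⊗ Q.id)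

  _◁_ : ∀ {m n} k → Step m n → Step (k + m) (k + n)
  k ◁ inj₁ f = inj₁ (P.id {k} P.⊗ f)
  k ◁ inj₂ f = inj₂ (Q.id {k} Q.⊗ f)

  _▷*_ : ∀ {m n} → Zigzag m n → ∀ k → Zigzag (m + k) (n + k)
  z ▷* k = gmap (_+ k) (_▷ k) z

  _◁*_ : ∀ {m n} k → Zigzag m n → Zigzag (k + m) (k + n)
  k ◁* z = gmap (k +_) (k ◁_) z

  infix  4 _∼_
  infixr 10 _⊗*_

  _⊗*_ : ∀ {m n m′ n′} → Zigzag m n → Zigzag m′ n′ → Zigzag (m + m′) (n + n′)
  _⊗*_ {m} {n} {m′} {n′} z w = (z ▷* m′) ◅◅ (n ◁* w)

  data _∼_ : ∀ {m n} → Rel (Zigzag m n) ℓ where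
    ∼-refl      : ∀ {m n} {z : Zigzag m n} → z ∼ z
    ∼-sym       : ∀ {m n} {z w : Zigzag m n} → z ∼ w → w ∼ z
    ∼-trans     : ∀ {m n} {z w v : Zigzag m n} → z ∼ w → w ∼ v → z ∼ v
    ◅◅-cong     : ∀ {m n k} {z z′ : Zigzag m n} {w w′ : Zigzag n k} →
                  z ∼ z′ → w ∼ w′ → z ◅◅ w ∼ z′ ◅◅ w′
    ⊗*-cong     : ∀ {m n m′ n′} {z z′ : Zigzag m n} {w w′ : Zigzag m′ n′} →
                  z ∼ z′ → w ∼ w′ → z ⊗* w ∼ z′ ⊗* w′
    cong₁       : ∀ {m n} {f g : P.Hom m n} → f P.≈ g → inj₁ f ◅ ε ∼ inj₁ g ◅ ε
    cong₂       : ∀ {m n} {f g : Q.Hom m n} → f Q.≈ g → inj₂ f ◅ ε ∼ inj₂ g ◅ ε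
    id₁         : ∀ {n} → inj₁ (P.id {n}) ◅ ε ∼ ε
    id₂         : ∀ {n} → inj₂ (Q.id {n}) ◅ ε ∼ ε
    merge₁      : ∀ {m n k} {f : P.Hom m n} {g : P.Hom n k} →
                  inj₁ f ◅ inj₁ g ◅ ε ∼ inj₁ (f P.⨾ g) ◅ ε
    merge₂      : ∀ {m n k} {f : Q.Hom m n} {g : Q.Hom n k} →
                  inj₂ f ◅ inj₂ g ◅ ε ∼ inj₂ (f Q.⨾ g) ◅ ε
    σ₁∼σ₂       : ∀ {m n} → inj₁ (P.σ m n) ◅ ε ∼ inj₂ (Q.σ m n) ◅ ε
    interchange : ∀ {m n m′ n′} (s : Step m n) (t : Step m′ n′) →
                  (s ▷ m′) ◅ (n ◁ t) ◅ ε ∼ (m ◁ t) ◅ (s ▷ n′) ◅ ε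

  private
    ≡⇒∼ : ∀ {m n} {z w : Zigzag m n} → z ≡ w → z ∼ w
    ≡⇒∼ ≡.refl = ∼-refl

    ◅◅-identityʳ : ∀ {m n} (z : Zigzag m n) → z ◅◅ ε ≡ z
    ◅◅-identityʳ ε       = ≡.refl
    ◅◅-identityʳ (s ◅ z) = ≡.cong (s ◅_) (◅◅-identityʳ z)

    cat : Category ℓ ℕ
    cat = record
      { Hom           = Zigzag
      ; _≈_           = _∼_
      ; isEquivalence = record { refl = ∼-refl ; sym = ∼-sym ; trans = ∼-trans }
      ; id            = ε
      ; _⨾_           = _◅◅_
      ; ⨾-cong        = ◅◅-cong
      ; assoc         = λ {_} {_} {_} {_} {z} {w} {v} → ≡⇒∼ (◅◅-assoc z w v)
      ; identityˡ     = ∼-refl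
      ; identityʳ     = λ {_} {_} {z} → ≡⇒∼ (◅◅-identityʳ z)
      }

    open Category cat using () renaming (coe to coe*)

    coe₁ : ∀ {m n} (e : m ≡ n) → coe* e ∼ inj₁ (P.coe e) ◅ ε
    coe₁ ≡.refl = ∼-sym id₁

    coe₂ : ∀ {m n} (e : m ≡ n) → coe* e ∼ inj₂ (Q.coe e) ◅ ε
    coe₂ ≡.refl = ∼-sym id₂

    glue : ∀ {m n k m′ n′ k′} (z : Zigzag m n) (w : Zigzag n k)
           (z′ : Zigzag m′ n′) (w′ : Zigzag n′ k′)
           (a : Zigzag m m′) (b : Zigzag n n′) (c : Zigzag k k′) →
           z ◅◅ b ∼ a ◅◅ z′ → w ◅◅ c ∼ b ◅◅ w′ → (z ◅◅ w) ◅◅ c ∼ a ◅◅ (z′ ◅◅ w′)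
    glue z w z′ w′ a b c p q =
      ∼-trans (≡⇒∼ (◅◅-assoc z w c))
      (∼-trans (◅◅-cong (∼-refl {z = z}) q)
      (∼-trans (≡⇒∼ (≡.sym (◅◅-assoc z b w′)))
      (∼-trans (◅◅-cong p (∼-refl {z = w′}))
      (≡⇒∼ (◅◅-assoc a z′ w′)))))

    natural : {φ ψ : ℕ → ℕ}
              (Φ : ∀ {m n} → Step m n → Step (φ m) (φ n))
              (Ψ : ∀ {m n} → Step m n → Step (ψ m) (ψ n))
              (c : ∀ n → Zigzag (φ n) (ψ n)) →
              (∀ {m n} (s : Step m n) → (Φ s ◅ ε) ◅◅ c n ∼ c m ◅◅ (Ψ s ◅ ε)) →
              ∀ {m n} (z : Zigzag m n) → gmap φ Φ z ◅◅ c n ∼ c m ◅◅ gmap ψ Ψ z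
    natural Φ Ψ c sq {m} ε = ≡⇒∼ (≡.sym (◅◅-identityʳ (c m)))
    natural {φ} {ψ} Φ Ψ c sq (s ◅ z) =
      glue (Φ s ◅ ε) (gmap φ Φ z) (Ψ s ◅ ε) (gmap ψ Ψ z) (c _) (c _) (c _) (sq s)
        (natural Φ Ψ c sq z)

    interchange* : ∀ {m n m′ n′} (z : Zigzag m n) (w : Zigzag m′ n′) →
                   (z ▷* m′) ◅◅ (n ◁* w) ∼ (m ◁* w) ◅◅ (z ▷* n′)
    interchange* {m} {n} z w = ∼-sym (natural (m ◁_) (n ◁_) (z ▷*_)
      (λ {m′} {n′} t → ∼-sym (natural (_▷ m′) (_▷ n′) (λ k → (k ◁ t) ◅ ε)
        (λ s → interchange s t) z)) w)

    step₁ : ∀ {m n m′ n′} (e : n ≡ n′) (d : m ≡ m′) {f : P.Hom m n} {g : P.Hom m′ n′} →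
            f P.⨾ P.coe e P.≈ P.coe d P.⨾ g →
            (inj₁ f ◅ ε) ◅◅ coe* e ∼ coe* d ◅◅ (inj₁ g ◅ ε)
    step₁ e d {f} {g} p = ∼-trans (◅◅-cong (∼-refl {z = inj₁ f ◅ ε}) (coe₁ e))
      (∼-trans merge₁ (∼-trans (cong₁ p) (∼-trans (∼-sym merge₁)
      (◅◅-cong (∼-sym (coe₁ d)) (∼-refl {z = inj₁ g ◅ ε})))))

    step₂ : ∀ {m n m′ n′} (e : n ≡ n′) (d : m ≡ m′) {f : Q.Hom m n} {g : Q.Hom m′ n′} →
            f Q.⨾ Q.coe e Q.≈ Q.coe d Q.⨾ g →
            (inj₂ f ◅ ε) ◅◅ coe* e ∼ coe* d ◅◅ (inj₂ g ◅ ε)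
    step₂ e d {f} {g} p = ∼-trans (◅◅-cong (∼-refl {z = inj₂ f ◅ ε}) (coe₂ e))
      (∼-trans merge₂ (∼-trans (cong₂ p) (∼-trans (∼-sym merge₂)
      (◅◅-cong (∼-sym (coe₂ d)) (∼-refl {z = inj₂ g ◅ ε})))))

    ▷▷ : ∀ k l {m n} (s : Step m n) →
         (((s ▷ k) ▷ l) ◅ ε) ◅◅ coe* (+-assoc n k l) ∼ coe* (+-assoc m k l) ◅◅ ((s ▷ (k + l)) ◅ ε)
    ▷▷ k l {m} {n} (inj₁ f) = step₁ (+-assoc n k l) (+-assoc m k l)
      (P.≈-trans P.⊗-assoc (P.⨾-congˡ (P.⊗-cong P.≈-refl P.⊗-id)))
    ▷▷ k l {m} {n} (inj₂ f) = step₂ (+-assoc n k l) (+-assoc m k l)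
      (Q.≈-trans Q.⊗-assoc (Q.⨾-congˡ (Q.⊗-cong Q.≈-refl Q.⊗-id)))

    ◁▷ : ∀ k l {m n} (s : Step m n) →
         (((k ◁ s) ▷ l) ◅ ε) ◅◅ coe* (+-assoc k n l) ∼ coe* (+-assoc k m l) ◅◅ ((k ◁ (s ▷ l)) ◅ ε)
    ◁▷ k l {m} {n} (inj₁ f) = step₁ (+-assoc k n l) (+-assoc k m l) P.⊗-assoc
    ◁▷ k l {m} {n} (inj₂ f) = step₂ (+-assoc k n l) (+-assoc k m l) Q.⊗-assoc

    ◁◁ : ∀ k l {m n} (s : Step m n) →
         (((k + l) ◁ s) ◅ ε) ◅◅ coe* (+-assoc k l n) ∼ coe* (+-assoc k l m) ◅◅ ((k ◁ (l ◁ s)) ◅ ε)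
    ◁◁ k l {m} {n} (inj₁ f) = step₁ (+-assoc k l n) (+-assoc k l m)
      (P.≈-trans (P.⨾-congʳ (P.⊗-cong (P.≈-sym P.⊗-id) P.≈-refl)) P.⊗-assoc)
    ◁◁ k l {m} {n} (inj₂ f) = step₂ (+-assoc k l n) (+-assoc k l m)
      (Q.≈-trans (Q.⨾-congʳ (Q.⊗-cong (Q.≈-sym Q.⊗-id) Q.≈-refl)) Q.⊗-assoc)

    ▷0 : ∀ {m n} (s : Step m n) →
         ((s ▷ zero) ◅ ε) ◅◅ coe* (+-identityʳ n) ∼ coe* (+-identityʳ m) ◅◅ (s ◅ ε)
    ▷0 {m} {n} (inj₁ f) = step₁ (+-identityʳ n) (+-identityʳ m) P.⊗-identityʳ
    ▷0 {m} {n} (inj₂ f) = step₂ (+-identityʳ n) (+-identityʳ m) Q.⊗-identityʳ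

    0◁ : ∀ {m n} (s : Step m n) → (zero ◁ s) ◅ ε ∼ s ◅ ε
    0◁ (inj₁ f) = cong₁ P.⊗-identityˡ
    0◁ (inj₂ f) = cong₂ Q.⊗-identityˡ

    0◁* : ∀ {m n} (z : Zigzag m n) → zero ◁* z ∼ z
    0◁* ε       = ∼-refl
    0◁* (s ◅ z) = ◅◅-cong {z = (zero ◁ s) ◅ ε} {z′ = s ◅ ε} (0◁ s) (0◁* z)

    ▷σ : ∀ k {m n} (s : Step m n) →
         ((s ▷ k) ◅ ε) ◅◅ (inj₁ (P.σ n k) ◅ ε) ∼ (inj₁ (P.σ m k) ◅ ε) ◅◅ ((k ◁ s) ◅ ε)
    ▷σ k (inj₁ f) = ∼-trans merge₁ (∼-trans (cong₁ P.σ-natural) (∼-sym merge₁))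
    ▷σ k {m} {n} (inj₂ f) =
      ∼-trans (◅◅-cong {z = inj₂ (f Q.⊗ Q.id) ◅ ε} ∼-refl σ₁∼σ₂)
      (∼-trans merge₂ (∼-trans (cong₂ Q.σ-natural) (∼-trans (∼-sym merge₂)
      (◅◅-cong {w = inj₂ (Q.id {k} Q.⊗ f) ◅ ε} (∼-sym σ₁∼σ₂) ∼-refl))))

    ◁σ : ∀ k {m n} (s : Step m n) →
         ((k ◁ s) ◅ ε) ◅◅ (inj₁ (P.σ k n) ◅ ε) ∼ (inj₁ (P.σ k m) ◅ ε) ◅◅ ((s ▷ k) ◅ ε)
    ◁σ k (inj₁ f) = ∼-trans merge₁ (∼-trans (cong₁ P.σ-natural) (∼-sym merge₁))
    ◁σ k {m} {n} (inj₂ f) =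
      ∼-trans (◅◅-cong {z = inj₂ (Q.id {k} Q.⊗ f) ◅ ε} ∼-refl σ₁∼σ₂)
      (∼-trans merge₂ (∼-trans (cong₂ Q.σ-natural) (∼-trans (∼-sym merge₂)
      (◅◅-cong {w = inj₂ (f Q.⊗ Q.id) ◅ ε} (∼-sym σ₁∼σ₂) ∼-refl))))

    ⊗*-◅◅ : ∀ {m n k m′ n′ k′} (z : Zigzag m n) (z′ : Zigzag n k)
            (w : Zigzag m′ n′) (w′ : Zigzag n′ k′) →
            (z ◅◅ z′) ⊗* (w ◅◅ w′) ∼ (z ⊗* w) ◅◅ (z′ ⊗* w′)
    ⊗*-◅◅ {m} {n} {k} {m′} {n′} {k′} z z′ w w′ =
      ∼-trans (◅◅-cong (≡⇒∼ (gmap-◅◅ (_+ m′) (_▷ m′) z z′)) (≡⇒∼ (gmap-◅◅ (k +_) (k ◁_) w w′)))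
      (∼-trans (≡⇒∼ (◅◅-assoc (z ▷* m′) (z′ ▷* m′) ((k ◁* w) ◅◅ (k ◁* w′))))
      (∼-trans (◅◅-cong (∼-refl {z = z ▷* m′})
        (∼-trans (≡⇒∼ (≡.sym (◅◅-assoc (z′ ▷* m′) (k ◁* w) (k ◁* w′))))
        (∼-trans (◅◅-cong (interchange* z′ w) (∼-refl {z = k ◁* w′}))
        (≡⇒∼ (◅◅-assoc (n ◁* w) (z′ ▷* n′) (k ◁* w′))))))
      (≡⇒∼ (≡.sym (◅◅-assoc (z ▷* m′) (n ◁* w) (z′ ⊗* w′))))))

    ⊗*-assoc : ∀ {m n m′ n′ m″ n″}
               (z : Zigzag m n) (w : Zigzag m′ n′) (v : Zigzag m″ n″) →
               ((z ⊗* w) ⊗* v) ◅◅ coe* (+-assoc n n′ n″) ∼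
               coe* (+-assoc m m′ m″) ◅◅ (z ⊗* (w ⊗* v))
    ⊗*-assoc {m} {n} {m′} {n′} {m″} {n″} z w v =
      ∼-trans (◅◅-cong {w = coe* (+-assoc n n′ n″)}
        (◅◅-cong {w = (n + n′) ◁* v} (≡⇒∼ (gmap-◅◅ (_+ m″) (_▷ m″) (z ▷* m′) (n ◁* w))) ∼-refl)
        ∼-refl)
      (∼-trans (glue (((z ▷* m′) ▷* m″) ◅◅ ((n ◁* w) ▷* m″)) ((n + n′) ◁* v)
                     ((z ▷* (m′ + m″)) ◅◅ (n ◁* (w ▷* m″))) (n ◁* (n′ ◁* v))
                     (coe* (+-assoc m m′ m″)) (coe* (+-assoc n n′ m″)) (coe* (+-assoc n n′ n″))
                     (glue ((z ▷* m′) ▷* m″) ((n ◁* w) ▷* m″)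
                           (z ▷* (m′ + m″)) (n ◁* (w ▷* m″))
                           (coe* (+-assoc m m′ m″)) (coe* (+-assoc n m′ m″)) (coe* (+-assoc n n′ m″))
                           outer middle) inner)
      (◅◅-cong (∼-refl {z = coe* (+-assoc m m′ m″)})
        (∼-trans (≡⇒∼ (◅◅-assoc (z ▷* (m′ + m″)) (n ◁* (w ▷* m″)) (n ◁* (n′ ◁* v))))
        (◅◅-cong (∼-refl {z = z ▷* (m′ + m″)})
          (≡⇒∼ (≡.sym (gmap-◅◅ (n +_) (n ◁_) (w ▷* m″) (n′ ◁* v))))))))
      where
      outer : ((z ▷* m′) ▷* m″) ◅◅ coe* (+-assoc n m′ m″) ∼
              coe* (+-assoc m m′ m″) ◅◅ (z ▷* (m′ + m″))
      outer = ∼-trans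
        (◅◅-cong {w = coe* (+-assoc n m′ m″)}
          (≡⇒∼ (gmap-∘ (_+ m″) (_▷ m″) (_+ m′) (_▷ m′) z)) ∼-refl)
        (natural (λ s → (s ▷ m′) ▷ m″) (_▷ (m′ + m″)) (λ k → coe* (+-assoc k m′ m″))
          (▷▷ m′ m″) z)
      middle : ((n ◁* w) ▷* m″) ◅◅ coe* (+-assoc n n′ m″) ∼
               coe* (+-assoc n m′ m″) ◅◅ (n ◁* (w ▷* m″))
      middle = ∼-trans
        (◅◅-cong {w = coe* (+-assoc n n′ m″)}
          (≡⇒∼ (gmap-∘ (_+ m″) (_▷ m″) (n +_) (n ◁_) w)) ∼-refl)
        (∼-trans
          (natural (λ s → (n ◁ s) ▷ m″) (λ s → n ◁ (s ▷ m″)) (λ k → coe* (+-assoc n k m″))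
            (◁▷ n m″) w)
          (◅◅-cong (∼-refl {z = coe* (+-assoc n m′ m″)})
            (≡⇒∼ (≡.sym (gmap-∘ (n +_) (n ◁_) (_+ m″) (_▷ m″) w)))))
      inner : ((n + n′) ◁* v) ◅◅ coe* (+-assoc n n′ n″) ∼
              coe* (+-assoc n n′ m″) ◅◅ (n ◁* (n′ ◁* v))
      inner = ∼-trans
        (natural ((n + n′) ◁_) (λ s → n ◁ (n′ ◁ s)) (λ k → coe* (+-assoc n n′ k)) (◁◁ n n′) v)
        (◅◅-cong (∼-refl {z = coe* (+-assoc n n′ m″)})
          (≡⇒∼ (≡.sym (gmap-∘ (n +_) (n ◁_) (n′ +_) (n′ ◁_) v))))

    ⊗*-identityʳ : ∀ {m n} (z : Zigzag m n) →
                   (z ⊗* ε {x = zero}) ◅◅ coe* (+-identityʳ n) ∼ coe* (+-identityʳ m) ◅◅ z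
    ⊗*-identityʳ {m} {n} z =
      ∼-trans (◅◅-cong {w = coe* (+-identityʳ n)} (≡⇒∼ (◅◅-identityʳ (z ▷* zero))) ∼-refl)
      (∼-trans (natural (_▷ zero) (λ s → s) (λ k → coe* (+-identityʳ k)) ▷0 z)
      (◅◅-cong (∼-refl {z = coe* (+-identityʳ m)}) (≡⇒∼ (gmap-id z))))

    σ*-natural : ∀ {m n m′ n′} (z : Zigzag m n) (w : Zigzag m′ n′) →
                 (z ⊗* w) ◅◅ (inj₁ (P.σ n n′) ◅ ε) ∼ (inj₁ (P.σ m m′) ◅ ε) ◅◅ (w ⊗* z)
    σ*-natural {m} {n} {m′} {n′} z w =
      ∼-trans (glue (z ▷* m′) (n ◁* w) (m′ ◁* z) (w ▷* n)
                (inj₁ (P.σ m m′) ◅ ε) (inj₁ (P.σ n m′) ◅ ε) (inj₁ (P.σ n n′) ◅ ε)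
                (natural (_▷ m′) (m′ ◁_) (λ k → inj₁ (P.σ k m′) ◅ ε) (▷σ m′) z)
                (natural (n ◁_) (_▷ n) (λ k → inj₁ (P.σ n k) ◅ ε) (◁σ n) w))
      (◅◅-cong (∼-refl {z = inj₁ (P.σ m m′) ◅ ε}) (∼-sym (interchange* w z)))

    σ*-hexagon : ∀ m n k →
      coe* (+-assoc m n k) ◅◅ ((inj₁ (P.σ m (n + k)) ◅ ε) ◅◅ coe* (+-assoc n k m)) ∼
      ((inj₁ (P.σ m n) ◅ ε) ⊗* ε {x = k}) ◅◅
      (coe* (+-assoc n m k) ◅◅ (ε {x = n} ⊗* (inj₁ (P.σ m k) ◅ ε)))
    σ*-hexagon m n k =
      ∼-trans (◅◅-cong (coe₁ (+-assoc m n k))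
                (◅◅-cong (∼-refl {z = inj₁ (P.σ m (n + k)) ◅ ε}) (coe₁ (+-assoc n k m))))
      (∼-trans (merge₃ (P.coe (+-assoc m n k)) (P.σ m (n + k)) (P.coe (+-assoc n k m)))
      (∼-trans (cong₁ P.σ-hexagon)
      (∼-trans (∼-sym (merge₃ (P.σ m n P.⊗ P.id) (P.coe (+-assoc n m k)) (P.id {n} P.⊗ P.σ m k)))
      (◅◅-cong (∼-refl {z = inj₁ (P.σ m n P.⊗ P.id {k}) ◅ ε})
        (◅◅-cong (∼-sym (coe₁ (+-assoc n m k)))
                 (∼-refl {z = inj₁ (P.id {n} P.⊗ P.σ m k) ◅ ε}))))))
      where
      merge₃ : ∀ {m n k l} (f : P.Hom m n) (g : P.Hom n k) (h : P.Hom k l) →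
               inj₁ f ◅ inj₁ g ◅ inj₁ h ◅ ε ∼ inj₁ (f P.⨾ (g P.⨾ h)) ◅ ε
      merge₃ f g h = ∼-trans (◅◅-cong (∼-refl {z = inj₁ f ◅ ε}) merge₁) merge₁

  prop : PropCategory ℓ
  prop = record
    { category     = cat
    ; _⊗_          = _⊗*_
    ; ⊗-cong       = ⊗*-cong
    ; ⊗-id         = ∼-refl
    ; ⊗-⨾          = λ {_} {_} {_} {_} {_} {_} {z} {z′} {w} {w′} → ⊗*-◅◅ z z′ w w′
    ; ⊗-assoc      = λ {_} {_} {_} {_} {_} {_} {z} {w} {v} → ⊗*-assoc z w v
    ; ⊗-identityˡ  = λ {_} {_} {z} → 0◁* z
    ; ⊗-identityʳ  = λ {_} {_} {z} → ⊗*-identityʳ z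
    ; σ            = λ m n → inj₁ (P.σ m n) ◅ ε
    ; σ-natural    = λ {_} {_} {_} {_} {z} {w} → σ*-natural z w
    ; σ-involutive = ∼-trans merge₁ (∼-trans (cong₁ P.σ-involutive) id₁)
    ; σ-hexagon    = λ {m} {n} {k} → σ*-hexagon m n k
    }

  ι₁ : PropFunctor P prop
  ι₁ = record
    { map      = λ f → inj₁ f ◅ ε
    ; map-cong = cong₁
    ; map-id   = id₁
    ; map-⨾    = ∼-sym merge₁
    ; map-⊗    = ∼-sym (∼-trans merge₁ (cong₁ (P.≈-trans (P.≈-sym P.⊗-⨾)
                   (P.⊗-cong P.identityʳ P.identityˡ))))
    ; map-σ    = ∼-refl
    }

  ι₂ : PropFunctor Q prop
  ι₂ = record
    { map      = λ f → inj₂ f ◅ ε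
    ; map-cong = cong₂
    ; map-id   = id₂
    ; map-⨾    = ∼-sym merge₂
    ; map-⊗    = ∼-sym (∼-trans merge₂ (cong₂ (Q.≈-trans (Q.≈-sym Q.⊗-⨾)
                   (Q.⊗-cong Q.identityʳ Q.identityˡ))))
    ; map-σ    = ∼-sym σ₁∼σ₂
    }

  module _ {X : PropCategory ℓ} (F : PropFunctor P X) (G : PropFunctor Q X) where
    private
      module F = PropFunctor F
      module G = PropFunctor G
      open PropCategory X
      open CategoryLemmas category

      step : ∀ {m n} → Step m n → Hom m n
      step (inj₁ f) = F.map f
      step (inj₂ g) = G.map g

      run : ∀ {m n} → Zigzag m n → Hom m n
      run ε       = id
      run (s ◅ z) = step s ⨾ run z

      run-◅◅ : ∀ {m n k} (z : Zigzag m n) (w : Zigzag n k) → run (z ◅◅ w) ≈ run z ⨾ run w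
      run-◅◅ ε       w = ≈-sym identityˡ
      run-◅◅ (s ◅ z) w = ≈-trans (⨾-congˡ (run-◅◅ z w)) (≈-sym assoc)

      step-▷ : ∀ {m n} (s : Step m n) k → step (s ▷ k) ≈ step s ⊗ id
      step-▷ (inj₁ f) k = ≈-trans F.map-⊗ (⊗-cong ≈-refl F.map-id)
      step-▷ (inj₂ g) k = ≈-trans G.map-⊗ (⊗-cong ≈-refl G.map-id)

      step-◁ : ∀ k {m n} (s : Step m n) → step (k ◁ s) ≈ id ⊗ step s
      step-◁ k (inj₁ f) = ≈-trans F.map-⊗ (⊗-cong F.map-id ≈-refl)
      step-◁ k (inj₂ g) = ≈-trans G.map-⊗ (⊗-cong G.map-id ≈-refl)

      run-▷* : ∀ {m n} (z : Zigzag m n) k → run (z ▷* k) ≈ run z ⊗ id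
      run-▷* ε       k = ≈-sym ⊗-id
      run-▷* (s ◅ z) k = ≈-trans (⨾-cong (step-▷ s k) (run-▷* z k))
        (≈-trans (≈-sym ⊗-⨾) (⊗-cong ≈-refl identityˡ))

      run-◁* : ∀ k {m n} (z : Zigzag m n) → run (k ◁* z) ≈ id ⊗ run z
      run-◁* k ε       = ≈-sym ⊗-id
      run-◁* k (s ◅ z) = ≈-trans (⨾-cong (step-◁ k s) (run-◁* k z))
        (≈-trans (≈-sym ⊗-⨾) (⊗-cong identityˡ ≈-refl))

      ⊗-split : ∀ {m n m′ n′} {f : Hom m n} {g : Hom m′ n′} → (f ⊗ id) ⨾ (id ⊗ g) ≈ f ⊗ g
      ⊗-split = ≈-trans (≈-sym ⊗-⨾) (⊗-cong identityʳ identityˡ)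

      ⊗-split′ : ∀ {m n m′ n′} {f : Hom m n} {g : Hom m′ n′} → (id ⊗ g) ⨾ (f ⊗ id) ≈ f ⊗ g
      ⊗-split′ = ≈-trans (≈-sym ⊗-⨾) (⊗-cong identityˡ identityʳ)

      run-⊗* : ∀ {m n m′ n′} (z : Zigzag m n) (w : Zigzag m′ n′) →
               run (z ⊗* w) ≈ run z ⊗ run w
      run-⊗* {n = n} {m′ = m′} z w =
        ≈-trans (run-◅◅ (z ▷* m′) (n ◁* w))
        (≈-trans (⨾-cong (run-▷* z m′) (run-◁* n w)) ⊗-split)

      run-cong : ∀ {m n} {z w : Zigzag m n} → z ∼ w → run z ≈ run w
      run-cong ∼-refl                                        = ≈-refl
      run-cong (∼-sym p)                                     = ≈-sym (run-cong p)
      run-cong (∼-trans p q)                                 = ≈-trans (run-cong p) (run-cong q)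
      run-cong (◅◅-cong {z = z} {z′} {w} {w′} p q)           =
        ≈-trans (run-◅◅ z w) (≈-trans (⨾-cong (run-cong p) (run-cong q)) (≈-sym (run-◅◅ z′ w′)))
      run-cong (⊗*-cong {z = z} {z′} {w} {w′} p q)           =
        ≈-trans (run-⊗* z w) (≈-trans (⊗-cong (run-cong p) (run-cong q)) (≈-sym (run-⊗* z′ w′)))
      run-cong (cong₁ p)                                     = ⨾-congʳ (F.map-cong p)
      run-cong (cong₂ p)                                     = ⨾-congʳ (G.map-cong p)
      run-cong id₁                                           = ≈-trans identityʳ F.map-id
      run-cong id₂                                           = ≈-trans identityʳ G.map-id
      run-cong merge₁                                        =
        ≈-trans (≈-sym assoc) (⨾-congʳ (≈-sym F.map-⨾))
      run-cong merge₂                                        =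
        ≈-trans (≈-sym assoc) (⨾-congʳ (≈-sym G.map-⨾))
      run-cong σ₁∼σ₂                                         =
        ⨾-congʳ (≈-trans F.map-σ (≈-sym G.map-σ))
      run-cong (interchange {m} {n} {m′} {n′} s t)           =
        ≈-trans (⨾-cong (step-▷ s m′) (≈-trans identityʳ (step-◁ n t)))
        (≈-trans ⊗-split (≈-sym (≈-trans
          (⨾-cong (step-◁ m t) (≈-trans identityʳ (step-▷ s n′))) ⊗-split′)))

    copair : PropFunctor prop X
    copair = record
      { map      = run
      ; map-cong = run-cong
      ; map-id   = ≈-refl
      ; map-⨾    = λ {_} {_} {_} {z} {w} → run-◅◅ z w
      ; map-⊗    = λ {_} {_} {_} {_} {z} {w} → run-⊗* z w
      ; map-σ    = ≈-trans identityʳ F.map-σ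
      }

    copair-unique : {U : PropFunctor prop X} →
                    (∀ {m n} (f : P.Hom m n) → PropFunctor.map U (inj₁ f ◅ ε) ≈ F.map f) →
                    (∀ {m n} (g : Q.Hom m n) → PropFunctor.map U (inj₂ g ◅ ε) ≈ G.map g) →
                    ∀ {m n} (z : Zigzag m n) → PropFunctor.map U z ≈ run z
    copair-unique {U} p q ε            = PropFunctor.map-id U
    copair-unique {U} p q (inj₁ f ◅ z) = ≈-trans
      (PropFunctor.map-⨾ U {f = inj₁ f ◅ ε} {g = z})
      (⨾-cong (p f) (copair-unique {U} p q z))
    copair-unique {U} p q (inj₂ g ◅ z) = ≈-trans
      (PropFunctor.map-⨾ U {f = inj₂ g ◅ ε} {g = z})
      (⨾-cong (q g) (copair-unique {U} p q z))

  isCoproduct : Category.IsCoproduct (PROP ℓ) ι₁ ι₂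
  isCoproduct = record
    { [_,_]   = copair
    ; inject₁ = λ {X} f → PropCategory.identityʳ X
    ; inject₂ = λ {X} g → PropCategory.identityʳ X
    ; unique  = λ {X} {F} {G} {U} → copair-unique F G {U}
    }

------------------------------------------------------------------------

module _ {C : PropCategory ℓ} (A : SubProp C) where
  open PropCategory C

  ⊗-PreservesPullbacks : Set ℓ
  ⊗-PreservesPullbacks = ⊗-PreservesPushouts (oppositeSub A)

  record Hypotheses (E M : MorphismClass) : Set ℓ where
    open SubProp A using (member)
    field
      pushouts      : HasPushouts
      pullbacks     : HasPullbacks category
      factorisation : IsFactorisationSystem category E M
      M-costable    : StableUnderPushout category M
      M-mono        : ∀ {m n} {f : Hom m n} → M f → IsMono f
      M⊆A           : ∀ {m n} {f : Hom m n} → M f → member f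
      A-stable      : StableUnderPullback category member
      induced∈M     : ∀ {X Y Z P Q} {f : Hom X Z} {g : Hom Y Z}
                      {p : Hom P X} {q : Hom P Y} {i : Hom X Q} {j : Hom Y Q} →
                      member f → member g →
                      (pb : IsPullback category f g p q) (po : IsPushout p q i j) →
                      M (IsPushout.universal po (pullback-commute category pb))
      ⊗-pushouts    : ⊗-PreservesPushouts (whole C)
      ⊗-pullbacks   : ⊗-PreservesPullbacks
      M-⊗           : ∀ {m n m′ n′} {f : Hom m n} {g : Hom m′ n′} → M f → M g → M (f ⊗ g)

module Square {C : PropCategory ℓ} {A : SubProp C}
  {E M : PropCategory.MorphismClass C} (H : Hypotheses A E M) where

  open PropCategory C
  open CategoryLemmas category
  open PushoutLemmas category
  open PropLemmas C
  open Hypotheses H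
  open SubProp A using (member)
  open IsFactorisationSystem factorisation using (M-subcategory)

  Cospanᶜ : ℕ → ℕ → Set ℓ
  Cospanᶜ = Cospan (whole C)

  -- left and right point from the apex to the feet, since they are legs in Cᵒᵖ.
  Spanᵃ : ℕ → ℕ → Set ℓ
  Spanᵃ = Cospan (oppositeSub A)

  module Cospans = CospanProp (whole C) pushouts (λ _ _ → _) ⊗-pushouts
  module Spans = CospanProp (oppositeSub A) pullbacks A-stable ⊗-pullbacks
  open Cospans using (_⨾ᶜ_; _⊗ᶜ_; ≅-refl)

  cospanProp : PropCategory ℓ
  cospanProp = Cospans.prop

  spanProp : PropCategory ℓ
  spanProp = Spans.prop

  infix 4 _⇝_ _~_

  record _⇝_ {m n} (c d : Cospanᶜ m n) : Set ℓ where
    private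
      module c = Cospan c
      module d = Cospan d
    field
      {arrow} : Hom c.apex d.apex
      arrow∈M : M arrow
      left    : c.left ⨾ arrow ≈ d.left
      right   : c.right ⨾ arrow ≈ d.right

  _~_ : ∀ {m n} → Rel (Cospanᶜ m n) ℓ
  _~_ = EqClosure _⇝_

  private
    ~-trans : ∀ {m n} {c d e : Cospanᶜ m n} → c ~ d → d ~ e → c ~ e
    ~-trans = EqC.transitive _⇝_

    ≅⇒~ : ∀ {m n} {c d : Cospanᶜ m n} → c ≅ d → c ~ d
    ≅⇒~ u = EqC.return record
      { arrow∈M = IsSubcategoryWithIsos.isos M-subcategory U.isIso
      ; left    = U.left
      ; right   = U.right
      } where module U = _≅_ u

    ⇝-⨾ˡ : ∀ {m n k} {c c′ : Cospanᶜ m n} (d : Cospanᶜ n k) → c ⇝ c′ → (c ⨾ᶜ d) ⇝ (c′ ⨾ᶜ d)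
    ⇝-⨾ˡ {c = c} {c′} d u = record
      { arrow   = po-mediate R.isPushout big
      ; arrow∈M = M-costable (po-cancel R.isPushout big) U.arrow∈M
      ; left    = ≈-trans (pullʳ (IsPushout.universal₁ R.isPushout _)) (pullˡ U.left)
      ; right   = pullʳ (IsPushout.universal₂ R.isPushout _)
      } where
        module U = _⇝_ u
        module R = Pushout (pushouts (Cospan.right c) (Cospan.left d))
        module R′ = Pushout (pushouts (Cospan.right c′) (Cospan.left d))
        big : IsPushout (Cospan.right c ⨾ U.arrow) (Cospan.left d) R′.in₁ R′.in₂
        big = po-≈ U.right ≈-refl R′.isPushout

    ⇝-⨾ʳ : ∀ {m n k} (c : Cospanᶜ m n) {d d′ : Cospanᶜ n k} → d ⇝ d′ → (c ⨾ᶜ d) ⇝ (c ⨾ᶜ d′)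
    ⇝-⨾ʳ c {d} {d′} u = record
      { arrow   = po-mediate (po-swap R.isPushout) big
      ; arrow∈M = M-costable (po-cancel (po-swap R.isPushout) big) U.arrow∈M
      ; left    = pullʳ (IsPushout.universal₁ R.isPushout _)
      ; right   = ≈-trans (pullʳ (IsPushout.universal₂ R.isPushout _)) (pullˡ U.right)
      } where
        module U = _⇝_ u
        module R = Pushout (pushouts (Cospan.right c) (Cospan.left d))
        module R′ = Pushout (pushouts (Cospan.right c) (Cospan.left d′))
        big : IsPushout (Cospan.left d ⨾ U.arrow) (Cospan.right c) R′.in₂ R′.in₁
        big = po-≈ U.left ≈-refl (po-swap R′.isPushout)

    ⇝-⊗ : ∀ {m n m′ n′} {c d : Cospanᶜ m n} {c′ d′ : Cospanᶜ m′ n′} →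
          c ⇝ d → c′ ⇝ d′ → (c ⊗ᶜ c′) ⇝ (d ⊗ᶜ d′)
    ⇝-⊗ u v = record
      { arrow∈M = M-⊗ U.arrow∈M V.arrow∈M
      ; left    = ≈-trans (≈-sym ⊗-⨾) (⊗-cong U.left V.left)
      ; right   = ≈-trans (≈-sym ⊗-⨾) (⊗-cong U.right V.right)
      } where module U = _⇝_ u
              module V = _⇝_ v

    ⇝-refl : ∀ {m n} {c : Cospanᶜ m n} → c ⇝ c
    ⇝-refl = record
      { arrow∈M = IsSubcategoryWithIsos.isos M-subcategory id-iso
      ; left    = identityʳ
      ; right   = identityʳ
      }

    ~-⨾ : ∀ {m n k} {c c′ : Cospanᶜ m n} {d d′ : Cospanᶜ n k} →
          c ~ c′ → d ~ d′ → (c ⨾ᶜ d) ~ (c′ ⨾ᶜ d′)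
    ~-⨾ {c′ = c′} {d} p q =
      ~-trans (EqC.gmap (_⨾ᶜ d) (⇝-⨾ˡ d) p) (EqC.gmap (c′ ⨾ᶜ_) (⇝-⨾ʳ c′) q)

    ~-⊗ : ∀ {m n m′ n′} {c d : Cospanᶜ m n} {c′ d′ : Cospanᶜ m′ n′} →
          c ~ d → c′ ~ d′ → (c ⊗ᶜ c′) ~ (d ⊗ᶜ d′)
    ~-⊗ {d = d} {c′} p q =
      ~-trans (EqC.gmap (_⊗ᶜ c′) (λ u → ⇝-⊗ u ⇝-refl) p)
              (EqC.gmap (d ⊗ᶜ_) (λ u → ⇝-⊗ ⇝-refl u) q)

  module Corelations =
    Quotient cospanProp _~_ (EqC.isEquivalence _⇝_) ≅⇒~ ~-⨾ ~-⊗

  corelProp : PropCategory ℓ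
  corelProp = Corelations.prop

  Γ : PropFunctor cospanProp corelProp
  Γ = Corelations.quotientFunctor

  pushoutCospan : ∀ {m n} → Spanᵃ m n → Cospanᶜ m n
  pushoutCospan s = cospan in₁ in₂ _ _
    where open Pushout (pushouts (Cospan.left s) (Cospan.right s))

  private
    pushoutCospan-via : ∀ {m n} (s : Spanᵃ m n) (c : Cospanᶜ m n) →
                        IsPushout (Cospan.left s) (Cospan.right s) (Cospan.left c) (Cospan.right c) →
                        pushoutCospan s ≅ c
    pushoutCospan-via s c po = record
      { isIso = po-iso R.isPushout po
      ; left  = IsPushout.universal₁ R.isPushout _
      ; right = IsPushout.universal₂ R.isPushout _
      } where module R = Pushout (pushouts (Cospan.left s) (Cospan.right s))

    pushoutCospan-cong : ∀ {m n} {s t : Spanᵃ m n} → s ≅ t → pushoutCospan s ≅ pushoutCospan t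
    pushoutCospan-cong {s = s} {t} u = pushoutCospan-via s (pushoutCospan t)
      (po-precompose (_≅_.iso u) (Category.IsIso.inv u-iso) (Category.IsIso.invʳ u-iso)
        (_≅_.left u) (_≅_.right u)
        (Pushout.isPushout (pushouts (Cospan.left t) (Cospan.right t))))
      where u-iso = _≅_.isIso u

    pushoutCospan-⨾ : ∀ {m n k} {s : Spanᵃ m n} {t : Spanᵃ n k} →
                      pushoutCospan (s Spans.⨾ᶜ t) ⇝ (pushoutCospan s ⨾ᶜ pushoutCospan t)
    pushoutCospan-⨾ {s = s} {t} = record
      { arrow   = w
      ; arrow∈M = M-costable
          (po-fold S.isPushout T.isPushout R.isPushout W.isPushout Y.isPushout
            (Y.universal₁ _) (Y.universal₂ _) (Y.universal₁ inner) (Y.universal₂ inner)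
            (W.universal₁ _) (W.universal₂ _))
          (induced∈M s.right∈ t.left∈ Pb.isPushout Y.isPushout)
      ; left    = W.universal₁ _
      ; right   = W.universal₂ _
      } where
      module s = Cospan s
      module t = Cospan t
      module Pb = Category.Pushout (pullbacks s.right t.left)
      module S where
        open Pushout (pushouts s.left s.right) public
        open IsPushout isPushout public
      module T where
        open Pushout (pushouts t.left t.right) public
        open IsPushout isPushout public
      module R where
        open Pushout (pushouts S.in₂ T.in₁) public
        open IsPushout isPushout public
      module W where
        open Pushout (pushouts (Pb.in₁ ⨾ s.left) (Pb.in₂ ⨾ t.right)) public
        open IsPushout isPushout public
      module Y where
        open Pushout (pushouts Pb.in₁ Pb.in₂) public
        open IsPushout isPushout public
      Pb-commute : Pb.in₁ ⨾ s.right ≈ Pb.in₂ ⨾ t.left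
      Pb-commute = pullback-commute category Pb.isPushout
      inner : Pb.in₁ ⨾ (s.left ⨾ W.in₁) ≈ Pb.in₂ ⨾ (t.right ⨾ W.in₂)
      inner = ≈-trans (≈-sym assoc) (≈-trans W.commute assoc)
      w : Hom W.apex R.apex
      w = W.universal (begin
        (Pb.in₁ ⨾ s.left) ⨾ (S.in₁ ⨾ R.in₁)  ≈⟨ pullʳ (≈-trans (pullˡ S.commute) assoc) ⟩
        Pb.in₁ ⨾ (s.right ⨾ (S.in₂ ⨾ R.in₁)) ≈⟨ pullˡ Pb-commute ⟩
        (Pb.in₂ ⨾ t.left) ⨾ (S.in₂ ⨾ R.in₁)  ≈⟨ ⨾-congˡ R.commute ⟩
        (Pb.in₂ ⨾ t.left) ⨾ (T.in₁ ⨾ R.in₂)  ≈⟨ pullʳ (≈-trans (pullˡ T.commute) assoc) ⟩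
        Pb.in₂ ⨾ (t.right ⨾ (T.in₂ ⨾ R.in₂)) ≈⟨ assoc ⟨
        (Pb.in₂ ⨾ t.right) ⨾ (T.in₂ ⨾ R.in₂) ∎)
        where open Reasoning

    pushoutCospan-⊗ : ∀ {m n m′ n′} {s : Spanᵃ m n} {t : Spanᵃ m′ n′} →
                      pushoutCospan (s Spans.⊗ᶜ t) ≅ (pushoutCospan s ⊗ᶜ pushoutCospan t)
    pushoutCospan-⊗ {s = s} {t} = pushoutCospan-via (s Spans.⊗ᶜ t) _
      (⊗-pushouts _ _ _ _
        (Pushout.isPushout (pushouts (Cospan.left s) (Cospan.right s)))
        (Pushout.isPushout (pushouts (Cospan.left t) (Cospan.right t))))

  Π : PropFunctor spanProp corelProp
  Π = record
    { map      = pushoutCospan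
    ; map-cong = λ u → ≅⇒~ (pushoutCospan-cong u)
    ; map-id   = ≅⇒~ (pushoutCospan-via Spans.idᶜ Cospans.idᶜ po-idˡ)
    ; map-⨾    = λ {_} {_} {_} {s} {t} → EqC.return (pushoutCospan-⨾ {s = s} {t})
    ; map-⊗    = λ {_} {_} {_} {_} {s} {t} → ≅⇒~ (pushoutCospan-⊗ {s = s} {t})
    ; map-σ    = λ {m} {n} → ≅⇒~ (pushoutCospan-via (Spans.σᶜ m n) (Cospans.σᶜ m n)
        (po-opposite-isos (≈-trans σ-involutive (≈-sym identityˡ)) id-iso σ-iso))
    }

  A⇒cospan : PropFunctor (SubProp.toProp A) cospanProp
  A⇒cospan = record
    { map      = λ (f , _) → Cospans.forward f _
    ; map-cong = λ p → Cospans.≅-legs p ≈-refl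
    ; map-id   = ≅-refl
    ; map-⨾    = Cospans.forward-⨾
    ; map-⊗    = Cospans.forward-⊗ᶜ
    ; map-σ    = ≅-refl
    }

  Aᵒᵖ⇒cospan : PropFunctor (oppositeProp (SubProp.toProp A)) cospanProp
  Aᵒᵖ⇒cospan = record
    { map      = λ (g , _) → Cospans.backward g _
    ; map-cong = λ p → Cospans.≅-legs ≈-refl p
    ; map-id   = ≅-refl
    ; map-⨾    = Cospans.backward-⨾
    ; map-⊗    = Cospans.backward-⊗ᶜ
    ; map-σ    = PropFunctor.map-σ Cospans.backwardFunctor
    }

  -- Forward and backward exchange roles in the opposite prop.

  A⇒span : PropFunctor (SubProp.toProp A) spanProp
  A⇒span = record
    { map      = λ (f , f∈) → Spans.backward f f∈
    ; map-cong = λ p → Spans.≅-legs ≈-refl p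
    ; map-id   = Spans.≅-refl
    ; map-⨾    = Spans.backward-⨾
    ; map-⊗    = Spans.backward-⊗ᶜ
    ; map-σ    = PropFunctor.map-σ Spans.backwardFunctor
    }

  Aᵒᵖ⇒span : PropFunctor (oppositeProp (SubProp.toProp A)) spanProp
  Aᵒᵖ⇒span = record
    { map      = λ (g , g∈) → Spans.forward g g∈
    ; map-cong = λ p → Spans.≅-legs p ≈-refl
    ; map-id   = Spans.≅-refl
    ; map-⨾    = Spans.forward-⨾
    ; map-⊗    = Spans.forward-⊗ᶜ
    ; map-σ    = Spans.≅-refl
    }

  module A+Aᵒᵖ = Coproduct (SubProp.toProp A) (oppositeProp (SubProp.toProp A))

  zigzagProp : PropCategory ℓ
  zigzagProp = A+Aᵒᵖ.prop

  toCospan : PropFunctor zigzagProp cospanProp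
  toCospan = A+Aᵒᵖ.copair A⇒cospan Aᵒᵖ⇒cospan

  toSpan : PropFunctor zigzagProp spanProp
  toSpan = A+Aᵒᵖ.copair A⇒span Aᵒᵖ⇒span

{-# OPTIONS --safe #-}

-- Let H on Cospan(C) and K on Span(A) agree on A + Aᵒᵖ. As Γ is the identity on
-- representatives, the mediating functor must be H itself, and it only has to be
-- checked that H is invariant under (f , g) ~ (f ⨾ m , g ⨾ m) with m ∈ M. The second
-- cospan is the first one with (m , id) ⨾ (id , m) inserted at the apex. By agreement,
-- H maps this composite to the K-image of (id , m) ⨾ (m , id) in Span(A), which is
-- computed by the kernel pair of m and hence is the identity, because m is a monomorphism.
-- That H ∘ Π agrees with K holds because a span (f , g) is the composite of a backward f
-- and a forward g, which in Cospan(C) is the pushout cospan of (f , g).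

module Submission where

open import Data.Product.Base using (_,_)
open import Data.Sum.Base using (inj₁; inj₂)
open import Level using (Level)
open import Relation.Binary.Construct.Closure.Equivalence using (gfold)
open import Relation.Binary.Construct.Closure.ReflexiveTransitive using (ε; _◅_)
open import Defs

private
  variable
    o ℓ : Level

module _ {Obj : Set o} (𝒞 : Category ℓ Obj) where
  open Category 𝒞
  open CategoryLemmas 𝒞

  coproduct-ext : ∀ {X Y S Z} {i : Hom X S} {j : Hom Y S} → IsCoproduct i j →
                  {u v : Hom S Z} → i ⨾ u ≈ i ⨾ v → j ⨾ u ≈ j ⨾ v → u ≈ v
  coproduct-ext c p q = ≈-trans (unique p q) (≈-sym (unique ≈-refl ≈-refl))
    where open IsCoproduct c

  mono⇒kernelPair : ∀ {X Y} {f : Hom X Y} → IsMono f → IsPullback 𝒞 f f id id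
  mono⇒kernelPair mono = record
    { commute    = ≈-refl
    ; universal  = λ {_} {h} _ → h
    ; universal₁ = λ _ → identityʳ
    ; universal₂ = λ eq → ≈-trans identityʳ (mono eq)
    ; unique     = λ _ p _ → ≈-trans (≈-sym identityʳ) p
    }

module _
  {P : PropCategory ℓ} (L : SubProp P)
  (pushouts  : PropCategory.HasPushouts P)
  (stable    : StableUnderPushout (PropCategory.category P) (SubProp.member L))
  (⊗-pushout : ⊗-PreservesPushouts L)
  where

  open PropCategory P
  open CospanProp L pushouts stable ⊗-pushout

  -- Both inner legs are identities, so nothing is glued. Stated for an arbitrary sub-prop so that
  -- it also covers spans, which are cospans in the opposite prop.
  forward⨾backward : ∀ {m n} (c : Cospan L m n) →
                     forward (Cospan.left c) (Cospan.left∈ c) ⨾ᶜ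
                     backward (Cospan.right c) (Cospan.right∈ c) ≅ c
  forward⨾backward c = ≅-trans (forward-⨾ᶜ _ (backward _ (Cospan.right∈ c)))
                               (≅-legs identityʳ ≈-refl)

module _ {C : PropCategory ℓ} {A : SubProp C} {E M : PropCategory.MorphismClass C}
         (H : Hypotheses A E M) where

  open PropCategory C
  open Hypotheses H
  open SubProp A using (member)
  open Square H
  open Cospans using (_⨾ᶜ_; forward; backward)

  private
    module PROP = Category (PROP ℓ)
    module Co = PropCategory cospanProp
    module Sp = PropCategory spanProp
    module Corel = PropCategory corelProp
    module Γ = PropFunctor Γ
    module Π = PropFunctor Π

  cospan-factor : ∀ {m n} (c : Cospanᶜ m n) →
                  forward (Cospan.left c) _ ⨾ᶜ backward (Cospan.right c) _ ≅ c
  cospan-factor = forward⨾backward (whole C) pushouts (λ _ _ → _) ⊗-pushouts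

  span-factor : ∀ {m n} (s : Spanᵃ m n) →
                Spans.forward (Cospan.left s) (Cospan.left∈ s) Spans.⨾ᶜ
                Spans.backward (Cospan.right s) (Cospan.right∈ s) ≅ s
  span-factor = forward⨾backward (oppositeSub A) pullbacks A-stable ⊗-pullbacks

  -- The composite is formed from the same chosen pushout, so the legs differ only by identities in
  -- front.
  pushoutCospan-factor : ∀ {m n} (s : Spanᵃ m n) →
                         pushoutCospan s ≅
                         backward (Cospan.left s) _ ⨾ᶜ forward (Cospan.right s) _
  pushoutCospan-factor s = Cospans.≅-legs (≈-sym identityˡ) (≈-sym identityˡ)

  -- As spans live in the opposite prop, `Spans.backward f f∈` is the span `(id , f)`. The composite
  -- therefore pulls `f` back along itself, which gives the trivial kernel pair.
  span-mono : ∀ {m n} {f : Hom m n} (f∈ : member f) → IsMono f →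
              Spans.backward f f∈ Spans.⨾ᶜ Spans.forward f f∈ ≅ Spans.idᶜ
  span-mono f∈ mono = Spans.⨾ᶜ-via (Spans.backward _ f∈) (Spans.forward _ f∈) Spans.idᶜ
    (mono⇒kernelPair category mono) identityˡ identityˡ

  -- It suffices to compare the two functors on the coproduct injections. A one-step zigzag
  -- evaluates to its step followed by an identity, which `identityʳ` removes.
  square-commutes : toCospan PROP.⨾ Γ PROP.≈ toSpan PROP.⨾ Π
  square-commutes = coproduct-ext (PROP ℓ) A+Aᵒᵖ.isCoproduct
    {u = toCospan PROP.⨾ Γ} {v = toSpan PROP.⨾ Π}
    (λ (f , f∈) → Corel.≈-trans
      (Γ.map-cong (Co.≈-trans Co.identityʳ (Co.≈-sym
        (Co.≈-trans (pushoutCospan-factor (Spans.backward f f∈)) Co.identityˡ))))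
      (Π.map-cong {f = Spans.backward f f∈} (Sp.≈-sym Sp.identityʳ)))
    (λ (g , g∈) → Corel.≈-trans
      (Γ.map-cong (Co.≈-trans Co.identityʳ (Co.≈-sym
        (Co.≈-trans (pushoutCospan-factor (Spans.forward g g∈)) Co.identityʳ))))
      (Π.map-cong {f = Spans.forward g g∈} (Sp.≈-sym Sp.identityʳ)))

  module Mediating {X : PropCategory ℓ}
                   {F : PropFunctor cospanProp X} {G : PropFunctor spanProp X}
                   (agree : toCospan PROP.⨾ F PROP.≈ toSpan PROP.⨾ G) where
    private
      module X = PropCategory X
      module F = PropFunctor F
      module G = PropFunctor G
      open CategoryLemmas X.category
      open Reasoning

    forward-agree : ∀ {m n} {f : Hom m n} (f∈ : member f) →
                    F.map (forward f _) X.≈ G.map (Spans.backward f f∈)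
    forward-agree f∈ = X.≈-trans (F.map-cong (Co.≈-sym Co.identityʳ))
      (X.≈-trans (agree (inj₁ (_ , f∈) ◅ ε)) (G.map-cong Sp.identityʳ))

    backward-agree : ∀ {m n} {g : Hom m n} (g∈ : member g) →
                     F.map (backward g _) X.≈ G.map (Spans.forward g g∈)
    backward-agree g∈ = X.≈-trans (F.map-cong (Co.≈-sym Co.identityʳ))
      (X.≈-trans (agree (inj₂ (_ , g∈) ◅ ε)) (G.map-cong Sp.identityʳ))

    M-cancels : ∀ {m n} {f : Hom m n} → M f →
                F.map (forward f _) X.⨾ F.map (backward f _) X.≈ X.id
    M-cancels {f = f} f∈M = begin
      F.map (forward f _) X.⨾ F.map (backward f _)
        ≈⟨ X.⨾-cong (forward-agree f∈) (backward-agree f∈) ⟩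
      G.map (Spans.backward f f∈) X.⨾ G.map (Spans.forward f f∈)
        ≈⟨ G.map-⨾ ⟨
      G.map (Spans.backward f f∈ Spans.⨾ᶜ Spans.forward f f∈)
        ≈⟨ G.map-cong (span-mono f∈ (M-mono f∈M)) ⟩
      G.map Spans.idᶜ
        ≈⟨ G.map-id ⟩
      X.id ∎
      where f∈ = M⊆A f∈M

    map-factor : ∀ {m n} (c : Cospanᶜ m n) →
                 F.map c X.≈
                 F.map (forward (Cospan.left c) _) X.⨾ F.map (backward (Cospan.right c) _)
    map-factor c = X.≈-trans (F.map-cong (Co.≈-sym (cospan-factor c))) F.map-⨾

    -- The composite is a separate `h` so that the leg equations of `_⇝_` fit directly.
    forward-⨾ : ∀ {m n k} {f : Hom m n} {g : Hom n k} {h : Hom m k} → f ⨾ g ≈ h →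
                F.map (forward h _) X.≈ F.map (forward f _) X.⨾ F.map (forward g _)
    forward-⨾ p = X.≈-trans
      (F.map-cong (Co.≈-trans (Cospans.≅-legs (≈-sym p) ≈-refl) Cospans.forward-⨾)) F.map-⨾

    backward-⨾ : ∀ {m n k} {f : Hom m n} {g : Hom n k} {h : Hom m k} → f ⨾ g ≈ h →
                 F.map (backward h _) X.≈ F.map (backward g _) X.⨾ F.map (backward f _)
    backward-⨾ p = X.≈-trans
      (F.map-cong (Co.≈-trans (Cospans.≅-legs ≈-refl (≈-sym p)) Cospans.backward-⨾)) F.map-⨾

    ⇝-invariant : ∀ {m n} {c d : Cospanᶜ m n} → c ⇝ d → F.map c X.≈ F.map d
    ⇝-invariant {c = c} {d} u = begin
      F.map c
        ≈⟨ map-factor c ⟩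
      F.map (forward c.left _) X.⨾ F.map (backward c.right _)
        -- Read backwards, this inserts the arrow and its reverse between the two legs.
        ≈⟨ X.⨾-congˡ (cancelˡ (M-cancels arrow∈M)) ⟨
      F.map (forward c.left _) X.⨾
      (F.map (forward arrow _) X.⨾ (F.map (backward arrow _) X.⨾ F.map (backward c.right _)))
        ≈⟨ X.assoc ⟨
      (F.map (forward c.left _) X.⨾ F.map (forward arrow _)) X.⨾
      (F.map (backward arrow _) X.⨾ F.map (backward c.right _))
        ≈⟨ X.⨾-cong (forward-⨾ left) (backward-⨾ right) ⟨
      F.map (forward d.left _) X.⨾ F.map (backward d.right _)
        ≈⟨ map-factor d ⟨
      F.map d ∎
      where
      module c = Cospan c
      module d = Cospan d
      open _⇝_ u

    mediating : PropFunctor corelProp X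
    mediating = record
      { map      = F.map
      -- Only equality of morphisms is coarser in corelations. Since `X.≈` is an equivalence,
      -- invariance under the generating relation suffices.
      ; map-cong = gfold X.isEquivalence F.map ⇝-invariant
      ; map-id   = F.map-id
      ; map-⨾    = F.map-⨾
      ; map-⊗    = λ {_} {_} {_} {_} {c} {d} → F.map-⊗ {f = c} {d}
      ; map-σ    = F.map-σ
      }

    mediating-Π : Π PROP.⨾ mediating PROP.≈ G
    mediating-Π s = begin
      F.map (pushoutCospan s)
        ≈⟨ F.map-cong (pushoutCospan-factor s) ⟩
      F.map (backward s.left _ ⨾ᶜ forward s.right _)
        ≈⟨ F.map-⨾ ⟩
      F.map (backward s.left _) X.⨾ F.map (forward s.right _)
        -- The legs of a span lie in `A`, where `F` and `G` can be compared.
        ≈⟨ X.⨾-cong (backward-agree s.left∈) (forward-agree s.right∈) ⟩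
      G.map (Spans.forward s.left s.left∈) X.⨾ G.map (Spans.backward s.right s.right∈)
        ≈⟨ G.map-⨾ ⟨
      G.map (Spans.forward s.left s.left∈ Spans.⨾ᶜ Spans.backward s.right s.right∈)
        ≈⟨ G.map-cong (span-factor s) ⟩
      G.map s ∎
      where module s = Cospan s

theorem3p11 : ∀ {ℓ : Level} (C : PropCategory ℓ) (A : SubProp C)
    (E M : PropCategory.MorphismClass C) (H : Hypotheses A E M) →
    let open Square H in
    Category.IsPushout (PROP ℓ) toCospan toSpan Γ Π
theorem3p11 C A E M H = record
  { commute    = square-commutes H
  ; universal  = λ {_} {F} {G} agree → Mediating.mediating H {F = F} {G} agree
  ; universal₁ = λ {X} _ _ → PropCategory.≈-refl X
  ; universal₂ = λ {_} {F} {G} agree → Mediating.mediating-Π H {F = F} {G} agree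
  -- Composing with `Γ` leaves values unchanged, so the first triangle is already the required
  -- equation.
  ; unique     = λ _ p _ → p
  }
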